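{- Let $r\ge1$ and $n\ge1$ be integers and let $q,z$ be indeterminates. Let $$L_q(-n,1,r)(z)=\sum_{\substack{m\ge1\\ m\equiv 1\ (\mathrm{mod}\ r)}}[m]_q^n\,z^m .$$ Then $$L_q(-n,1,r)(z)=z\,\frac{G_{r,n}(z^r,q)}{(z^r;q^r)_{n+1}},$$ where $G_{r,n}(Z,q)=\sum_{\gamma\in G(r,n)}Z^{\mathrm{des}_G(\gamma)}q^{\mathrm{fmaj}(\gamma)}$ is the generating polynomial of the group $G(r,n)$ of $r$-coloured permutations.
   Context: Notation: $[m]_q=\frac{1-q^m}{1-q}$, and $(a;q)_n=(1-a)(1-aq)\cdots(1-aq^{n-1})$. $L_q(-n,c,r)(z)$ is the value on the power series $f(z)=z$ of the operator $L_q(s,c,r)=\sum_{m\ge1,\ m\equiv c\,(\mathrm{mod}\ r)}\frac{1}{[m]_q^s}F_m$ at $s=-n$, where $F_m(f)(q,z)=f(q^m,z^m)$ acts on formal power series in $z$ without constant term over $\mathbb{Q}(q)$; for $c=1$ this gives the displayed series. The identity is one of formal power series in $z$ over $\mathbb{Q}(q)$. Coloured permutations: for $r,n\ge1$, $G(r,n)=\{(c_1,\dots,c_n;\sigma): c_i\in\{0,\dots,r-1\},\ \sigma\in S_n\}$, and an element is written $\gamma=[\gamma(1),\dots,\gamma(n)]=[\sigma(1)^{c_1},\dots,\sigma(n)^{c_n}]$. The possible values are totally ordered, together with the symbol $0$, by $$n^{r-1}<\dots<n^1<\dots<1^{r-1}<\dots<1^1<0<1^0<\dots<n^0 .$$ Set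 $\gamma(0):=0$, $\mathrm{Des}_G(\gamma)=\{i\in\{0,\dots,n-1\}:\gamma(i)>\gamma(i+1)\}$, $\mathrm{des}_G(\gamma)=|\mathrm{Des}_G(\gamma)|$, $\mathrm{maj}(\gamma)=\sum_{i\in\mathrm{Des}_G(\gamma)}i$, $\mathrm{col}(\gamma)=\sum_{i=1}^n c_i$, and $\mathrm{fmaj}(\gamma)=r\cdot\mathrm{maj}(\gamma)+\mathrm{col}(\gamma)$. -}

module Defs where

open import Level using (0ℓ)
open import Function using (_∘_)
open import Data.Nat as ℕ using (ℕ; zero; suc; _∸_)
import Data.Nat.ListAction as ListAction
open import Data.Nat.DivMod using (_%_)
open import Data.Fin as Fin using (Fin; zero; suc; toℕ; inject₁)
import Data.Fin.Properties as Fin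
open import Data.List as List using (List; []; _∷_)
open import Data.List.Relation.Unary.Any using (Any; here; there; any?)
open import Data.Product using (_×_; _,_; proj₁; ∃)
open import Data.Rational as ℚ using (ℚ; 0ℚ; 1ℚ)
import Data.Rational.Properties as ℚ
open import Data.Vec as Vec using (Vec; []; _∷_)
open import Data.Vec.Relation.Unary.Unique.Propositional using (Unique)
import Data.Vec.Relation.Unary.AllPairs as AllPairs
open import Algebra.Bundles using (RawRing)
open import Algebra.Core using (Op₁)
open import Algebra.Definitions.RawSemiring using (sum; product)
import Algebra.Definitions.RawSemiring as RawSemiringDefs
open import Relation.Nullary using (Dec; yes; no; ¬?; _×-dec_)
open import Relation.Binary.PropositionalEquality
  using (_≡_; _≢_; refl; sym; trans; cong; cong₂; module ≡-Reasoning)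

------------------------------------------------------------------------
-- The polynomial ring ℚ[q]

-- Lists of coefficients, constant term first; trailing zeros are allowed,
-- so equality is equality of all coefficients.
ℚ[q] : Set
ℚ[q] = List ℚ

module Poly where

  infix  4 _≈_
  infixl 6 _+_
  infixl 7 _*_ _·_
  infix  8 -_

  coeff : ℚ[q] → ℕ → ℚ
  coeff []      _       = 0ℚ
  coeff (a ∷ _) zero    = a
  coeff (_ ∷ p) (suc k) = coeff p k

  _≈_ : ℚ[q] → ℚ[q] → Set
  p ≈ s = ∀ k → coeff p k ≡ coeff s k

  _+_ : ℚ[q] → ℚ[q] → ℚ[q]
  []      + s       = s
  (a ∷ p) + []      = a ∷ p
  (a ∷ p) + (b ∷ s) = a ℚ.+ b ∷ p + s

  -_ : ℚ[q] → ℚ[q]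
  - p = List.map (λ a → ℚ.- a) p

  _·_ : ℚ → ℚ[q] → ℚ[q]
  a · s = List.map (a ℚ.*_) s

  _*_ : ℚ[q] → ℚ[q] → ℚ[q]
  []      * _ = []
  (a ∷ p) * s = a · s + (0ℚ ∷ p * s)

  Nonzero : ℚ[q] → Set
  Nonzero = Any (_≢ 0ℚ)

  nonzero? : ∀ p → Dec (Nonzero p)
  nonzero? = any? λ a → ¬? (a ℚ.≟ 0ℚ)

  private
    coeff-+ : ∀ p s k → coeff (p + s) k ≡ coeff p k ℚ.+ coeff s k
    coeff-+ []      s       k       = sym (ℚ.+-identityˡ _)
    coeff-+ (a ∷ p) []      k       = sym (ℚ.+-identityʳ _)
    coeff-+ (a ∷ p) (b ∷ s) zero    = refl
    coeff-+ (a ∷ p) (b ∷ s) (suc k) = coeff-+ p s k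

    coeff-· : ∀ a s k → coeff (a · s) k ≡ a ℚ.* coeff s k
    coeff-· a []      k       = sym (ℚ.*-zeroʳ a)
    coeff-· a (b ∷ s) zero    = refl
    coeff-· a (b ∷ s) (suc k) = coeff-· a s k

    coeff-* : ∀ a p s k →
      coeff ((a ∷ p) * s) k ≡ a ℚ.* coeff s k ℚ.+ coeff (0ℚ ∷ p * s) k
    coeff-* a p s k = trans (coeff-+ (a · s) (0ℚ ∷ p * s) k)
                            (cong (ℚ._+ coeff (0ℚ ∷ p * s) k) (coeff-· a s k))

    shiftˡ : ∀ p s k → coeff ((0ℚ ∷ p) * s) k ≡ coeff (0ℚ ∷ p * s) k
    shiftˡ p s k = trans (coeff-* 0ℚ p s k)
      (trans (cong (ℚ._+ coeff (0ℚ ∷ p * s) k) (ℚ.*-zeroˡ (coeff s k)))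
             (ℚ.+-identityˡ _))

    shiftʳ : ∀ p s k → coeff (p * (0ℚ ∷ s)) k ≡ coeff (0ℚ ∷ p * s) k
    shiftʳ []      s zero    = refl
    shiftʳ []      s (suc k) = refl
    shiftʳ (a ∷ p) s zero    =
      trans (coeff-* a p (0ℚ ∷ s) 0) (trans (ℚ.+-identityʳ _) (ℚ.*-zeroʳ a))
    shiftʳ (a ∷ p) s (suc k) =
      trans (coeff-* a p (0ℚ ∷ s) (suc k))
        (trans (cong (a ℚ.* coeff s k ℚ.+_) (shiftʳ p s k))
               (sym (coeff-* a p s k)))

    *-≢0 : ∀ {a b} → a ≢ 0ℚ → b ≢ 0ℚ → a ℚ.* b ≢ 0ℚ
    *-≢0 {a} {b} a≢0 b≢0 ab≡0 = b≢0 (begin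
      b                         ≡⟨ ℚ.*-identityˡ b ⟨
      1ℚ ℚ.* b                  ≡⟨ cong (ℚ._* b) (ℚ.*-inverseˡ a) ⟨
      (ℚ.1/ a ℚ.* a) ℚ.* b      ≡⟨ ℚ.*-assoc (ℚ.1/ a) a b ⟩
      ℚ.1/ a ℚ.* (a ℚ.* b)      ≡⟨ cong (ℚ.1/ a ℚ.*_) ab≡0 ⟩
      ℚ.1/ a ℚ.* 0ℚ             ≡⟨ ℚ.*-zeroʳ (ℚ.1/ a) ⟩
      0ℚ                        ∎)
      where
      open ≡-Reasoning
      instance _ = ℚ.≢-nonZero a≢0

    toCoeff : ∀ {p} → Nonzero p → ∃ λ k → coeff p k ≢ 0ℚ
    toCoeff (here a≢0) = 0 , a≢0
    toCoeff (there p≢0) with toCoeff p≢0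
    ... | k , pₖ≢0 = suc k , pₖ≢0

    fromCoeff : ∀ p k → coeff p k ≢ 0ℚ → Nonzero p
    fromCoeff []      k       0≢0  with () ← 0≢0 refl
    fromCoeff (a ∷ p) zero    a≢0  = here a≢0
    fromCoeff (a ∷ p) (suc k) pₖ≢0 = there (fromCoeff p k pₖ≢0)

    shift-nonzero : ∀ p s → (∀ k → coeff s k ≡ coeff (0ℚ ∷ p) k) →
                    Nonzero p → Nonzero s
    shift-nonzero p s eq p≢0 with toCoeff p≢0
    ... | k , pₖ≢0 = fromCoeff s (suc k) (pₖ≢0 ∘ trans (sym (eq (suc k))))

    headˡ : ∀ {a} p {s} → a ≢ 0ℚ → Nonzero s → Nonzero ((a ∷ p) * s)
    headˡ {a} p {b ∷ s} a≢0 s≢0 with b ℚ.≟ 0ℚ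
    ... | no b≢0 = fromCoeff ((a ∷ p) * (b ∷ s)) 0
                     (*-≢0 a≢0 b≢0 ∘ trans (sym (trans (coeff-* a p (b ∷ s) 0)
                                                       (ℚ.+-identityʳ _))))
    headˡ p {_ ∷ s} a≢0 (here 0≢0)  | yes refl with () ← 0≢0 refl
    headˡ {a} p {_ ∷ s} a≢0 (there s≢0) | yes refl =
      shift-nonzero ((a ∷ p) * s) _ (shiftʳ (a ∷ p) s) (headˡ p a≢0 s≢0)

  *-nonzero : ∀ {p s} → Nonzero p → Nonzero s → Nonzero (p * s)
  *-nonzero {a ∷ p} {s} p≢0 s≢0 with a ℚ.≟ 0ℚ
  ... | no a≢0 = headˡ p a≢0 s≢0
  *-nonzero {_ ∷ p} {s} (here 0≢0)  s≢0 | yes refl with () ← 0≢0 refl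
  *-nonzero {_ ∷ p} {s} (there p≢0) s≢0 | yes refl =
    shift-nonzero (p * s) _ (shiftˡ p s) (*-nonzero p≢0 s≢0)

------------------------------------------------------------------------
-- The field ℚ(q) of fractions of ℚ[q]

record ℚ⟨q⟩ : Set where
  constructor _÷_[_]
  field
    num   : ℚ[q]
    den   : ℚ[q]
    den≢0 : Poly.Nonzero den

module Frac where

  open ℚ⟨q⟩
  open Poly using (*-nonzero; nonzero?)

  infix  4 _≈_
  infixl 6 _+_
  infixl 7 _*_
  infix  8 -_
  infix  9 _⁻¹

  fromPoly : ℚ[q] → ℚ⟨q⟩
  fromPoly p = p ÷ (1ℚ ∷ []) [ here ℚ.1≢0 ]

  _≈_ : ℚ⟨q⟩ → ℚ⟨q⟩ → Set
  x ≈ y = num x Poly.* den y Poly.≈ num y Poly.* den x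

  _+_ : ℚ⟨q⟩ → ℚ⟨q⟩ → ℚ⟨q⟩
  x + y = (num x Poly.* den y Poly.+ num y Poly.* den x)
          ÷ (den x Poly.* den y) [ *-nonzero (den≢0 x) (den≢0 y) ]

  _*_ : ℚ⟨q⟩ → ℚ⟨q⟩ → ℚ⟨q⟩
  x * y = (num x Poly.* num y)
          ÷ (den x Poly.* den y) [ *-nonzero (den≢0 x) (den≢0 y) ]

  -_ : ℚ⟨q⟩ → ℚ⟨q⟩
  - x = (Poly.- num x) ÷ den x [ den≢0 x ]

  -- Total, with the convention 0⁻¹ = 0.
  _⁻¹ : ℚ⟨q⟩ → ℚ⟨q⟩
  x ⁻¹ with nonzero? (num x)
  ... | yes num≢0 = den x ÷ num x [ num≢0 ]
  ... | no  _     = fromPoly []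

ℚ⟨q⟩-rawRing : RawRing 0ℓ 0ℓ
ℚ⟨q⟩-rawRing = record
  { Carrier = ℚ⟨q⟩
  ; _≈_     = Frac._≈_
  ; _+_     = Frac._+_
  ; _*_     = Frac._*_
  ; -_      = Frac.-_
  ; 0#      = Frac.fromPoly []
  ; 1#      = Frac.fromPoly (1ℚ ∷ [])
  }

------------------------------------------------------------------------
-- q-notation

module QNotation (R : RawRing 0ℓ 0ℓ) where

  open RawRing R
  open RawSemiringDefs rawSemiring using (_^_)

  -- (a;q)_n
  pochhammer : (a q : Carrier) → ℕ → Carrier
  pochhammer a q n =
    product rawSemiring {n} λ i → 1# + - (a * q ^ toℕ i)

  -- [m]_q, for a given inversion operation
  qNumber : Op₁ Carrier → (q : Carrier) → ℕ → Carrier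
  qNumber _⁻¹ q m = (1# + - (q ^ m)) * ((1# + - q) ⁻¹)

------------------------------------------------------------------------
-- Formal power series in one variable z over a field K

module PowerSeries (K : RawRing 0ℓ 0ℓ) (_⁻¹ : Op₁ (RawRing.Carrier K)) where

  open RawRing K

  infixl 7 _/_

  Series : Set
  Series = ℕ → Carrier

  const : Carrier → Series
  const a zero    = a
  const a (suc _) = 0#

  z : Series
  z 1 = 1#
  z _ = 0#

  rawRing : RawRing 0ℓ 0ℓ
  rawRing = record
    { Carrier = Series
    ; _≈_     = λ f g → ∀ k → f k ≈ g k
    ; _+_     = λ f g k → f k + g k
    ; _*_     = λ f g k →
        sum rawSemiring {suc k} λ i → f (toℕ i) * g (k ∸ toℕ i)
    ; -_      = λ f k → - f k
    ; 0#      = const 0#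
    ; 1#      = const 1#
    }

  -- The coefficients g_k, …, g_0 (in this order) of the reciprocal g of a
  -- series f with f_0 ≠ 0, from f_0 g_0 = 1 and
  -- f_0 g_{k+1} + f_1 g_k + … + f_{k+1} g_0 = 0.
  recipCoeffs : Series → (k : ℕ) → Vec Carrier (suc k)
  recipCoeffs f zero    = (f 0) ⁻¹ ∷ []
  recipCoeffs f (suc k) =
    - ((f 0 ⁻¹) * sum rawSemiring {suc k}
                    (λ i → f (suc (toℕ i)) * Vec.lookup gs i)) ∷ gs
    where gs = recipCoeffs f k

  recip : Series → Series
  recip f k = Vec.head (recipCoeffs f k)

  _/_ : Series → Series → Series
  f / g = RawRing._*_ rawRing f (recip g)

------------------------------------------------------------------------
-- Coloured permutations

-- Fin n stands for {1, …, n}, in the same order. A permutation σ is given by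
-- the word σ(1) … σ(n), whose letters are distinct.
record ColouredPerm (r n : ℕ) : Set where
  constructor ⟨_,_,_⟩
  field
    colour : Vec (Fin r) n
    σ      : Vec (Fin n) n
    unique : Unique σ

words : ∀ {A : Set} → List A → (n : ℕ) → List (Vec A n)
words letters zero    = [] ∷ []
words letters (suc n) = List.cartesianProductWith _∷_ letters (words letters n)

distinct? : ∀ {m n} (w : Vec (Fin m) n) → Dec (Unique w)
distinct? = AllPairs.allPairs? λ i j → ¬? (i Fin.≟ j)

-- All elements of G(r,n), each listed once.
G : (r n : ℕ) → List (ColouredPerm r n)
G r n = List.concatMap colourings (words (List.allFin n) n)
  where
  colourings : Vec (Fin n) n → List (ColouredPerm r n)
  colourings w with distinct? w
  ... | yes w! = List.map (λ c → ⟨ c , w , w! ⟩) (words (List.allFin r) n)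
  ... | no  _  = []

data Symbol (r n : ℕ) : Set where
  𝟎   : Symbol r n
  _↑_ : Fin n → Fin r → Symbol r n

infix 4 _≺_ _≺?_

-- With v ↑ c for v^c:
-- n^{r-1} ≺ … ≺ n^1 ≺ … ≺ 1^{r-1} ≺ … ≺ 1^1 ≺ 0 ≺ 1^0 ≺ … ≺ n^0
data _≺_ : ∀ {r n} → Symbol r n → Symbol r n → Set where
  value  : ∀ {r n} {v w : Fin n} {c d : Fin r} →
           w Fin.< v → (v ↑ suc c) ≺ (w ↑ suc d)
  colour : ∀ {r n} {v : Fin n} {c d : Fin r} →
           d Fin.< c → (v ↑ suc c) ≺ (v ↑ suc d)
  col≺𝟎  : ∀ {r n} {v : Fin n} {c : Fin r} → (v ↑ suc c) ≺ 𝟎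
  col≺un : ∀ {r n} {v w : Fin n} {c : Fin r} → (v ↑ suc c) ≺ (w ↑ zero)
  𝟎≺un   : ∀ {r n} {w : Fin n} → 𝟎 ≺ (w ↑ zero {r})
  un≺un  : ∀ {r n} {v w : Fin n} → v Fin.< w → (v ↑ zero {r}) ≺ (w ↑ zero)

_≺?_ : ∀ {r n} (x y : Symbol r n) → Dec (x ≺ y)
𝟎           ≺? 𝟎           = no λ ()
𝟎           ≺? (w ↑ zero)  = yes 𝟎≺un
𝟎           ≺? (w ↑ suc d) = no λ ()
(v ↑ zero)  ≺? 𝟎           = no λ ()
(v ↑ suc c) ≺? 𝟎           = yes col≺𝟎
(v ↑ zero)  ≺? (w ↑ suc d) = no λ ()
(v ↑ suc c) ≺? (w ↑ zero)  = yes col≺un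
(v ↑ zero)  ≺? (w ↑ zero) with v Fin.<? w
... | yes v<w = yes (un≺un v<w)
... | no  v≮w = no λ { (un≺un v<w) → v≮w v<w }
(v ↑ suc c) ≺? (w ↑ suc d) with w Fin.<? v | (v Fin.≟ w) ×-dec (d Fin.<? c)
... | yes w<v | _                = yes (value w<v)
... | no  _   | yes (refl , d<c) = yes (colour d<c)
... | no  w≮v | no  ¬colour      = no λ where
  (value w<v)  → w≮v w<v
  (colour d<c) → ¬colour (refl , d<c)

module _ {r n : ℕ} (γ : ColouredPerm r n) where

  open ColouredPerm γ using (σ) renaming (colour to c)

  -- γ(0), γ(1), …, γ(n), with γ(0) = 0
  oneLine : Vec (Symbol r n) (suc n)
  oneLine = 𝟎 ∷ Vec.zipWith _↑_ σ c

  Des : List (Fin n)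
  Des = List.filter
    (λ i → Vec.lookup oneLine (suc i) ≺? Vec.lookup oneLine (inject₁ i))
    (List.allFin n)

  des maj col fmaj : ℕ
  des  = List.length Des
  maj  = ListAction.sum (List.map toℕ Des)
  col  = Vec.sum (Vec.map toℕ c)
  fmaj = r ℕ.* maj ℕ.+ col

-- G_{r,n}(Z,q), evaluated at elements Z and q of a commutative ring
generatingPolynomial : (R : RawRing 0ℓ 0ℓ) (r n : ℕ) →
                       (Z q : RawRing.Carrier R) → RawRing.Carrier R
generatingPolynomial R r n Z q =
  List.foldr _+_ 0# (List.map (λ γ → Z ^ des γ * q ^ fmaj γ) (G r n))
  where
  open RawRing R
  open RawSemiringDefs rawSemiring using (_^_)

------------------------------------------------------------------------
-- The polylogarithm L_q(-n,c,r)(z)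

module Lq (K : RawRing 0ℓ 0ℓ) (_⁻¹ : Op₁ (RawRing.Carrier K))
          (q : RawRing.Carrier K) where

  open RawRing K
  open RawSemiringDefs rawSemiring using (_^_)

  -- Σ [m]_q^n z^m over m ≥ 1 with m ≡ c (mod r)
  L : (n c r : ℕ) .{{_ : ℕ.NonZero r}} → ℕ → Carrier
  L n c r m with (1 ℕ.≤? m) ×-dec (m % r ℕ.≟ c % r)
  ... | yes _ = QNotation.qNumber K _⁻¹ q m ^ n
  ... | no  _ = 0#

------------------------------------------------------------------------
-- Specialisation to ℚ(q)[[z]]

q : ℚ⟨q⟩
q = Frac.fromPoly (0ℚ ∷ 1ℚ ∷ [])

open PowerSeries ℚ⟨q⟩-rawRing Frac._⁻¹ public
  renaming (rawRing to ℚ⟨q⟩⟦z⟧)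

open Lq ℚ⟨q⟩-rawRing Frac._⁻¹ q public

-- For k ≥ 0 let r a + c stand for a level a and a colour c, and order the
-- letters by decreasing level, then by ≺. For a set S of values, W k x S sums
-- q^{Σ f} over the functions f on S all of whose letters come after
-- (level k, symbol x). It is a product over S, and W k 𝟎 {1,…,n} = [rk+1]^n.
--
-- Splitting off the first letter y of f, and telescoping along the order,
-- shows that A(x,S)(Z) = Σ W k x S Z^k satisfies
--   (1 - Z) A(x,S)(Z) = Σ_y Z^{[y ≺ x]} q^{col y} A(y, S - y)(q^r Z).
-- Splitting off the first letter of a word gives the same recursion, without
-- the factor 1 - Z, for Σ Z^des q^fmaj over the words with set of values S.
-- Hence (Z;q^r)_{|S|+1} A(x,S)(Z) is that sum, and the case x = 𝟎,
-- S = {1,…,n}, Z = z^r is the theorem.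

module Submission where

open import Defs
open import Level using (0ℓ)
open import Function using (_∘_; id)
open import Data.Bool using (Bool; true; false; not; _∧_; if_then_else_)
open import Data.Nat as ℕ using (ℕ; zero; suc; NonZero; _∸_)
import Data.Nat.Properties as ℕ
import Data.Nat.DivMod as ℕ
import Data.Nat.ListAction as ListAction
open import Data.Nat.Tactic.RingSolver using (solve-∀)
open import Data.Fin as Fin using (Fin; zero; suc; toℕ; inject₁)
import Data.Fin.Properties as Fin
open import Data.Fin.Subset using (Subset; ∣_∣; ⊤)
import Data.Fin.Subset.Properties as Subset
open import Data.List as List using (List; []; _∷_)
import Data.List.Properties as List
open import Data.List.Relation.Unary.Any using (here; there)
open import Data.List.Relation.Unary.All as All using (All; []; _∷_)
import Data.List.Relation.Unary.All.Properties as All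
open import Data.List.Relation.Unary.AllPairs as AllPairs using (AllPairs; []; _∷_)
import Data.List.Relation.Unary.AllPairs.Properties as AllPairs
import Data.List.Relation.Unary.Linked.Properties as Linked
import Data.List.Relation.Unary.Unique.Propositional.Properties as Unique
open import Data.List.Relation.Binary.Permutation.Propositional as ↭ using (_↭_; prep; swap; ↭-sym; ↭⇒↭ₛ)
import Data.List.Relation.Binary.Permutation.Propositional.Properties as ↭
import Data.List.Relation.Binary.Permutation.Setoid.Properties as ↭ₛ
import Data.List.Sort as Sort
open import Data.Product using (_,_; _×_; proj₁; proj₂; ∃)
open import Data.Rational as ℚ using (ℚ; 0ℚ; 1ℚ)
import Data.Rational.Properties as ℚ
open import Data.Sum using (inj₁; inj₂)
open import Data.Vec as Vec using (Vec; []; _∷_; lookup; _[_]≔_)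
import Data.Vec.Properties as Vec
open import Data.Vec.Relation.Unary.All as VecAll using ([]; _∷_)
open import Data.Vec.Relation.Unary.AllPairs using ([]; _∷_)
open import Data.Vec.Relation.Unary.Unique.Propositional using (Unique)
open import Algebra.Bundles using (RawRing; CommutativeRing)
open import Algebra.Core using (Op₁)
import Algebra.Definitions.RawSemiring as RawSemiringDefs
open import Algebra.Morphism.Structures using (IsRingMonomorphism)
import Algebra.Morphism.RingMonomorphism as RingMonomorphism
import Algebra.Properties.CommutativeSemiring.Exp as Exp
import Algebra.Properties.Ring as RingProperties
open import Algebra.Structures using (IsCommutativeRing)
import Algebra.Solver.Ring.NaturalCoefficients.Default as Solver
open import Relation.Binary.Bundles using (StrictTotalOrder; DecTotalOrder)
open import Relation.Binary.Definitions using (Trichotomous; Tri; tri<; tri≈; tri>)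
import Relation.Binary.Properties.StrictTotalOrder as StrictTotalOrderProperties
open import Relation.Binary.PropositionalEquality as ≡ using (_≡_; _≢_)
import Relation.Binary.Reasoning.Setoid as SetoidReasoning
open import Relation.Nullary using (¬_; Dec; yes; no; does; contradiction; _×-dec_)
open import Relation.Nullary.Decidable using (dec-true; dec-false; decidable-stable)

-- Power series over a commutative ring

-- Why descents appear: when the letters of f are read in order, the symbols increase inside a
-- level, so each descent of the resulting coloured word forces a drop in level; a descent at
-- position 0 keeps the first letter off level k. No bijection is built, the recursion replaces it.
-- Its two sides treat ties differently: descents ask whether y ≺ x, later letters are those with x
-- ≺ y, and these are complementary only for y ≠ x. Hence `Fresh`: it holds at the start because 𝟎
-- is no letter, and afterwards because the value of x has left S. The empty S is a case apart: W is
-- then 1 at every level, and the geometric series supplies the last Pochhammer factor. For nonempty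
-- S the constant left by telescoping vanishes at k = 0, since [0] = 0. The argument q^r Z is
-- carried by a scalar a that multiplies the k-th coefficient by a^k. Equations stay multiplied out,
-- and a reciprocal series occurs only at the end. The recursion is proved over any commutative ring
-- in which 1 - q has an inverse; ℚ(q) enters last.

module SeriesRing (K : CommutativeRing 0ℓ 0ℓ) (_⁻¹ : Op₁ (CommutativeRing.Carrier K)) where

  open CommutativeRing K hiding (zero)
  open SetoidReasoning setoid
  open Solver commutativeSemiring using (solve; _:=_; _:+_; _:*_; con)
  open RawSemiringDefs (RawRing.rawSemiring rawRing) using (sum)
  open RingProperties ring using (-‿distribʳ-*)

  private
    module PS = PowerSeries rawRing _⁻¹
    module S = RawRing PS.rawRing

  -- The convolution unfolds so that coefficient `suc k` of `f S.* g` is definitionally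
  -- `f 0 * g (suc k) + (tail f S.* g) k`. The ring laws below are therefore inductions on the
  -- index, with f replaced by its tail.
  tail : PS.Series → PS.Series
  tail f k = f (suc k)

  infixr 7 _·_
  _·_ : Carrier → PS.Series → PS.Series
  (a · f) k = a * f k

  *-congₛ : ∀ {f f′ g g′} → f S.≈ f′ → g S.≈ g′ → f S.* g S.≈ f′ S.* g′
  *-congₛ f≈ g≈ zero    = +-congʳ (*-cong (f≈ 0) (g≈ 0))
  *-congₛ f≈ g≈ (suc k) =
    +-cong (*-cong (f≈ 0) (g≈ (suc k))) (*-congₛ (f≈ ∘ suc) g≈ k)

  *-distribʳₛ : ∀ h f g → (f S.+ g) S.* h S.≈ f S.* h S.+ g S.* h
  *-distribʳₛ h f g zero = solve 3 (λ a b c → (a :+ b) :* c :+ con 0 := (a :* c :+ con 0) :+ (b :* c :+ con 0)) refl (f 0) (g 0) (h 0)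
  *-distribʳₛ h f g (suc k) = begin
    (f 0 + g 0) * h (suc k) + (tail (f S.+ g) S.* h) k
      ≈⟨ +-congˡ (*-distribʳₛ h (tail f) (tail g) k) ⟩
    (f 0 + g 0) * h (suc k) + ((tail f S.* h) k + (tail g S.* h) k)
      ≈⟨ solve 5 (λ a b c x y → (a :+ b) :* c :+ (x :+ y) := (a :* c :+ x) :+ (b :* c :+ y)) refl
           (f 0) (g 0) (h (suc k)) _ _ ⟩
    (f S.* h) (suc k) + (g S.* h) (suc k) ∎

  ·-*-assoc : ∀ a f g → (a · f) S.* g S.≈ a · (f S.* g)
  ·-*-assoc a f g zero = begin
    a * f 0 * g 0 + 0#   ≈⟨ +-identityʳ _ ⟩
    a * f 0 * g 0        ≈⟨ *-assoc _ _ _ ⟩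
    a * (f 0 * g 0)      ≈⟨ *-congˡ (+-identityʳ _) ⟨
    a * (f 0 * g 0 + 0#) ∎
  ·-*-assoc a f g (suc k) = begin
    a * f 0 * g (suc k) + ((a · tail f) S.* g) k ≈⟨ +-cong (*-assoc _ _ _) (·-*-assoc a (tail f) g k) ⟩
    a * (f 0 * g (suc k)) + a * (tail f S.* g) k ≈⟨ distribˡ _ _ _ ⟨
    a * (f S.* g) (suc k)                        ∎

  -- The tail of `f S.* g` is definitionally `f 0 · tail g S.+ tail f S.* g`, so distributivity and
  -- scalar associativity lead back to the preceding index.
  *-assocₛ : ∀ f g h → (f S.* g) S.* h S.≈ f S.* (g S.* h)
  *-assocₛ f g h zero = +-congʳ (begin
    (f 0 * g 0 + 0#) * h 0 ≈⟨ *-congʳ (+-identityʳ _) ⟩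
    f 0 * g 0 * h 0        ≈⟨ *-assoc _ _ _ ⟩
    f 0 * (g 0 * h 0)      ≈⟨ *-congˡ (+-identityʳ _) ⟨
    f 0 * (g 0 * h 0 + 0#) ∎)
  *-assocₛ f g h (suc k) = begin
    (f 0 * g 0 + 0#) * h (suc k) + ((f 0 · tail g S.+ tail f S.* g) S.* h) k
      ≈⟨ +-cong (*-congʳ (+-identityʳ _)) (*-distribʳₛ h (f 0 · tail g) (tail f S.* g) k) ⟩
    f 0 * g 0 * h (suc k) + (((f 0 · tail g) S.* h) k + ((tail f S.* g) S.* h) k)
      ≈⟨ +-congˡ (+-cong (·-*-assoc (f 0) (tail g) h k) (*-assocₛ (tail f) g h k)) ⟩
    f 0 * g 0 * h (suc k) + (f 0 * (tail g S.* h) k + (tail f S.* (g S.* h)) k)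
      ≈⟨ solve 5 (λ a b c x y → a :* b :* c :+ (a :* x :+ y) := a :* (b :* c :+ x) :+ y) refl
           (f 0) (g 0) (h (suc k)) _ _ ⟩
    f 0 * (g 0 * h (suc k) + (tail g S.* h) k) + (tail f S.* (g S.* h)) k ∎

  -- Mirror image of the definitional recursion, with the last summand of the convolution split off;
  -- commutativity exchanges the two.
  *-sucʳ : ∀ f g k → (f S.* g) (suc k) ≈ (f S.* tail g) k + f (suc k) * g 0
  *-sucʳ f g zero    = trans (+-congˡ (+-identityʳ _)) (+-congʳ (sym (+-identityʳ _)))
  *-sucʳ f g (suc k) = trans (+-congˡ (*-sucʳ (tail f) g k)) (sym (+-assoc _ _ _))

  *-commₛ : ∀ f g → f S.* g S.≈ g S.* f
  *-commₛ f g zero    = +-congʳ (*-comm _ _)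
  *-commₛ f g (suc k) = begin
    f 0 * g (suc k) + (tail f S.* g) k   ≈⟨ +-cong (*-comm _ _) (*-commₛ (tail f) g k) ⟩
    g (suc k) * f 0 + (g S.* tail f) k   ≈⟨ +-comm _ _ ⟩
    (g S.* tail f) k + g (suc k) * f 0   ≈⟨ *-sucʳ g f k ⟨
    (g S.* f) (suc k)                    ∎

  0*ₛ : ∀ f g → (∀ k → f k ≈ 0#) → ∀ k → (f S.* g) k ≈ 0#
  0*ₛ f g f≈0 zero    = trans (+-identityʳ _) (trans (*-congʳ (f≈0 0)) (zeroˡ _))
  0*ₛ f g f≈0 (suc k) = begin
    f 0 * g (suc k) + (tail f S.* g) k ≈⟨ +-cong (*-congʳ (f≈0 0)) (0*ₛ (tail f) g (f≈0 ∘ suc) k) ⟩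
    0# * g (suc k) + 0#                ≈⟨ +-identityʳ _ ⟩
    0# * g (suc k)                     ≈⟨ zeroˡ _ ⟩
    0#                                 ∎

  const-* : ∀ a g → PS.const a S.* g S.≈ a · g
  const-* a g zero    = +-identityʳ _
  const-* a g (suc k) = trans (+-congˡ (0*ₛ (tail (PS.const a)) g (λ _ → refl) k)) (+-identityʳ _)

  const-0 : ∀ k → PS.const 0# k ≈ 0#
  const-0 zero    = refl
  const-0 (suc k) = refl

  *-identityˡₛ : ∀ f → S.1# S.* f S.≈ f
  *-identityˡₛ f k = trans (const-* 1# f k) (*-identityˡ _)

  commutativeRing : CommutativeRing 0ℓ 0ℓ
  commutativeRing = record
    { Carrier = PS.Series
    ; _≈_     = S._≈_
    ; _+_     = S._+_
    ; _*_     = S._*_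
    ; -_      = S.-_
    ; 0#      = S.0#
    ; 1#      = S.1#
    ; isCommutativeRing = record
      { isRing = record
        { +-isAbelianGroup = record
          { isGroup = record
            { isMonoid = record
              { isSemigroup = record
                { isMagma = record
                  { isEquivalence = record
                    { refl  = λ k → refl
                    ; sym   = λ p k → sym (p k)
                    ; trans = λ p q k → trans (p k) (q k)
                    }
                  ; ∙-cong = λ p q k → +-cong (p k) (q k)
                  }
                ; assoc = λ f g h k → +-assoc _ _ _
                }
              ; identity = (λ f k → trans (+-congʳ (const-0 k)) (+-identityˡ _))
                         , (λ f k → trans (+-congˡ (const-0 k)) (+-identityʳ _))
              }
            ; inverse = (λ f k → trans (-‿inverseˡ _) (sym (const-0 k)))
                      , (λ f k → trans (-‿inverseʳ _) (sym (const-0 k)))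
            ; ⁻¹-cong = λ p k → -‿cong (p k)
            }
          ; comm = λ f g k → +-comm _ _
          }
        ; *-cong     = *-congₛ
        ; *-assoc    = *-assocₛ
        ; *-identity = *-identityˡₛ
                     , λ f k → trans (*-commₛ f S.1# k) (*-identityˡₛ f k)
        ; distrib    = (λ h f g k → trans (*-commₛ h (f S.+ g) k)
                         (trans (*-distribʳₛ h f g k) (+-cong (*-commₛ f h k) (*-commₛ g h k))))
                     , *-distribʳₛ
        }
      ; *-comm = *-commₛ
      }
    }

  sum-cong : ∀ {n} {f g : Fin n → Carrier} → (∀ i → f i ≈ g i) → sum f ≈ sum g
  sum-cong {zero}  f≈g = refl
  sum-cong {suc n} f≈g = +-cong (f≈g zero) (sum-cong (f≈g ∘ suc))

  -- The stored coefficients run downwards from index k, so the sum in the definition of the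
  -- reciprocal is a genuine convolution and cancels in `recip-inverseʳ`.
  lookup-recipCoeffs : ∀ f k (i : Fin (suc k)) →
    Vec.lookup (PS.recipCoeffs f k) i ≡ PS.recip f (k ∸ toℕ i)
  lookup-recipCoeffs f zero    zero    = ≡.refl
  lookup-recipCoeffs f (suc k) zero    = ≡.refl
  lookup-recipCoeffs f (suc k) (suc i) = lookup-recipCoeffs f k i

  recip-inverseʳ : ∀ f → f 0 * (f 0) ⁻¹ ≈ 1# → f S.* PS.recip f S.≈ S.1#
  recip-inverseʳ f f₀ zero    = trans (+-identityʳ _) f₀
  recip-inverseʳ f f₀ (suc k) = begin
    f 0 * - ((f 0) ⁻¹ * s) + (tail f S.* PS.recip f) k
      ≈⟨ +-congˡ (sum-cong {suc k} λ i → *-congˡ {f (suc (toℕ i))} (reflexive (lookup-recipCoeffs f k i))) ⟨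
    f 0 * - ((f 0) ⁻¹ * s) + s
      ≈⟨ +-congʳ (-‿distribʳ-* _ _) ⟨
    - (f 0 * ((f 0) ⁻¹ * s)) + s
      ≈⟨ +-congʳ (-‿cong (trans (sym (*-assoc _ _ _)) (trans (*-congʳ f₀) (*-identityˡ s)))) ⟩
    - s + s
      ≈⟨ -‿inverseˡ s ⟩
    0# ∎
    where s = sum {suc k} λ i → f (suc (toℕ i)) * Vec.lookup (PS.recipCoeffs f k) i

-- The field ℚ(q)

module ℚ⟦q⟧ = SeriesRing ℚ.+-*-commutativeRing id

ℚ[q]-rawRing : RawRing 0ℓ 0ℓ
ℚ[q]-rawRing = record
  { Carrier = ℚ[q]
  ; _≈_     = Poly._≈_
  ; _+_     = Poly._+_
  ; _*_     = Poly._*_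
  ; -_      = Poly.-_
  ; 0#      = []
  ; 1#      = 1ℚ ∷ []
  }

module _ where

  open Poly
  open CommutativeRing ℚ⟦q⟧.commutativeRing using () renaming (_*_ to _*ₛ_; _≈_ to _≈ₛ_)

  coeff-+ : ∀ p s k → coeff (p + s) k ≡ coeff p k ℚ.+ coeff s k
  coeff-+ []      s       k       = ≡.sym (ℚ.+-identityˡ _)
  coeff-+ (a ∷ p) []      k       = ≡.sym (ℚ.+-identityʳ _)
  coeff-+ (a ∷ p) (b ∷ s) zero    = ≡.refl
  coeff-+ (a ∷ p) (b ∷ s) (suc k) = coeff-+ p s k

  coeff-· : ∀ a s k → coeff (a · s) k ≡ a ℚ.* coeff s k
  coeff-· a []      k       = ≡.sym (ℚ.*-zeroʳ a)
  coeff-· a (b ∷ s) zero    = ≡.refl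
  coeff-· a (b ∷ s) (suc k) = coeff-· a s k

  coeff-neg : ∀ p k → coeff (- p) k ≡ ℚ.- coeff p k
  coeff-neg []      k       = ≡.refl
  coeff-neg (a ∷ p) zero    = ≡.refl
  coeff-neg (a ∷ p) (suc k) = coeff-neg p k

  coeff-* : ∀ p s → coeff (p * s) ≈ₛ coeff p *ₛ coeff s
  coeff-* []      s k       = ≡.sym (ℚ⟦q⟧.0*ₛ (coeff []) (coeff s) (λ _ → ≡.refl) k)
  coeff-* (a ∷ p) s zero    = ≡.trans (coeff-+ (a · s) _ 0) (≡.cong (ℚ._+ 0ℚ) (coeff-· a s 0))
  coeff-* (a ∷ p) s (suc k) = ≡.trans (coeff-+ (a · s) _ (suc k))
    (≡.cong₂ ℚ._+_ (coeff-· a s (suc k)) (coeff-* p s k))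

  -- The ring axioms for coefficient lists are pulled back from ℚ⟦q⟧, which avoids inductions over
  -- lists of different lengths. Injectivity is `id` because equality of polynomials is defined on
  -- coefficients.
  coeff-isRingMonomorphism :
    IsRingMonomorphism ℚ[q]-rawRing (CommutativeRing.rawRing ℚ⟦q⟧.commutativeRing) coeff
  coeff-isRingMonomorphism = record
    { isRingHomomorphism = record
      { isSemiringHomomorphism = record
        { isNearSemiringHomomorphism = record
          { +-isMonoidHomomorphism = record
            { isMagmaHomomorphism = record
              { isRelHomomorphism = record { cong = id }
              ; homo = coeff-+
              }
            ; ε-homo = λ { zero → ≡.refl ; (suc k) → ≡.refl }
            }
          ; *-homo = coeff-*
          }
        ; 1#-homo = λ { zero → ≡.refl ; (suc k) → ≡.refl }
        }
      ; -‿homo = coeff-neg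
      }
    ; injective = id
    }

ℚ[q]-commutativeRing : CommutativeRing 0ℓ 0ℓ
ℚ[q]-commutativeRing = record
  { isCommutativeRing =
      RingMonomorphism.isCommutativeRing coeff-isRingMonomorphism
        (CommutativeRing.isCommutativeRing ℚ⟦q⟧.commutativeRing)
  }

Nonzero⇒≉0 : ∀ {p} → Poly.Nonzero p → ¬ p Poly.≈ []
Nonzero⇒≉0 (here a≢0)  p≈0 = a≢0 (p≈0 0)
Nonzero⇒≉0 (there p≢0) p≈0 = Nonzero⇒≉0 p≢0 (p≈0 ∘ suc)

¬Nonzero⇒≈0 : ∀ p → ¬ Poly.Nonzero p → p Poly.≈ []
¬Nonzero⇒≈0 []      _  k       = ≡.refl
¬Nonzero⇒≈0 (a ∷ p) p≡0 zero    = decidable-stable (a ℚ.≟ 0ℚ) (p≡0 ∘ here)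
¬Nonzero⇒≈0 (a ∷ p) p≡0 (suc k) = ¬Nonzero⇒≈0 p (p≡0 ∘ there) k

-- The axioms for fractions after cross multiplication. Over an abstract ring the numerators and
-- denominators remain variables for the solver.
module FracIdentities (R : CommutativeRing 0ℓ 0ℓ) where
  open CommutativeRing R
  open SetoidReasoning setoid
  open RingProperties ring
  open Solver commutativeSemiring using (solve; _:=_; _:+_; _:*_)

  difference-lemma : ∀ {d p s} → p * d ≈ s * d → (p - s) * d ≈ 0#
  difference-lemma {d} {p} {s} pd≈sd = begin
    (p - s) * d       ≈⟨ distribʳ d p (- s) ⟩
    p * d + - s * d   ≈⟨ +-cong pd≈sd (sym (-‿distribˡ-* s d)) ⟩
    s * d - s * d     ≈⟨ -‿inverseʳ (s * d) ⟩
    0#                ∎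

  -- Cross multiplication yields transitivity only up to the middle denominator d, which must then
  -- be cancelled; here ℚ[q] has to be a domain.
  trans-lemma : ∀ {a b c d e f} → a * d ≈ c * b → c * f ≈ e * d → (a * f) * d ≈ (e * b) * d
  trans-lemma {a} {b} {c} {d} {e} {f} p s = begin
    (a * f) * d ≈⟨ solve 3 (λ a d f → (a :* f) :* d := (a :* d) :* f) refl a d f ⟩
    (a * d) * f ≈⟨ *-congʳ p ⟩
    (c * b) * f ≈⟨ solve 3 (λ c b f → (c :* b) :* f := (c :* f) :* b) refl c b f ⟩
    (c * f) * b ≈⟨ *-congʳ s ⟩
    (e * d) * b ≈⟨ solve 3 (λ e d b → (e :* d) :* b := (e :* b) :* d) refl e d b ⟩
    (e * b) * d ∎

  +-cong-lemma : ∀ {a b c d a′ b′ c′ d′} → a * b′ ≈ a′ * b → c * d′ ≈ c′ * d →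
    (a * d + c * b) * (b′ * d′) ≈ (a′ * d′ + c′ * b′) * (b * d)
  +-cong-lemma {a} {b} {c} {d} {a′} {b′} {c′} {d′} p s = begin
    (a * d + c * b) * (b′ * d′)
      ≈⟨ solve 6 (λ a b c d b′ d′ → (a :* d :+ c :* b) :* (b′ :* d′) := (a :* b′) :* (d :* d′) :+ (c :* d′) :* (b :* b′)) refl a b c d b′ d′ ⟩
    (a * b′) * (d * d′) + (c * d′) * (b * b′)
      ≈⟨ +-cong (*-congʳ p) (*-congʳ s) ⟩
    (a′ * b) * (d * d′) + (c′ * d) * (b * b′)
      ≈⟨ solve 6 (λ a′ b c′ d b′ d′ → (a′ :* b) :* (d :* d′) :+ (c′ :* d) :* (b :* b′) := (a′ :* d′ :+ c′ :* b′) :* (b :* d)) refl a′ b c′ d b′ d′ ⟩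
    (a′ * d′ + c′ * b′) * (b * d) ∎

  *-cong-lemma : ∀ {a b c d a′ b′ c′ d′} → a * b′ ≈ a′ * b → c * d′ ≈ c′ * d →
    (a * c) * (b′ * d′) ≈ (a′ * c′) * (b * d)
  *-cong-lemma {a} {b} {c} {d} {a′} {b′} {c′} {d′} p s = begin
    (a * c) * (b′ * d′)   ≈⟨ solve 4 (λ a c b′ d′ → (a :* c) :* (b′ :* d′) := (a :* b′) :* (c :* d′)) refl a c b′ d′ ⟩
    (a * b′) * (c * d′)   ≈⟨ *-cong p s ⟩
    (a′ * b) * (c′ * d)   ≈⟨ solve 4 (λ a c b′ d′ → (a :* b′) :* (c :* d′) := (a :* c) :* (b′ :* d′)) refl a′ c′ b d ⟩
    (a′ * c′) * (b * d)   ∎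

  neg-cong-lemma : ∀ {a b a′ b′} → a * b′ ≈ a′ * b → - a * b′ ≈ - a′ * b
  neg-cong-lemma {a} {b} {a′} {b′} p = begin
    - a * b′   ≈⟨ -‿distribˡ-* a b′ ⟨
    - (a * b′) ≈⟨ -‿cong p ⟩
    - (a′ * b) ≈⟨ -‿distribˡ-* a′ b ⟩
    - a′ * b   ∎

  +-assoc-lemma : ∀ a b c d e f →
    ((a * d + c * b) * f + e * (b * d)) * (b * (d * f)) ≈ (a * (d * f) + (c * f + e * d) * b) * ((b * d) * f)
  +-assoc-lemma = solve 6 (λ a b c d e f →
    ((a :* d :+ c :* b) :* f :+ e :* (b :* d)) :* (b :* (d :* f)) := (a :* (d :* f) :+ (c :* f :+ e :* d) :* b) :* ((b :* d) :* f)) refl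

  +-comm-lemma : ∀ a b c d → (a * d + c * b) * (d * b) ≈ (c * b + a * d) * (b * d)
  +-comm-lemma = solve 4 (λ a b c d → (a :* d :+ c :* b) :* (d :* b) := (c :* b :+ a :* d) :* (b :* d)) refl

  +-identityʳ-lemma : ∀ a b → (a * 1# + 0# * b) * b ≈ a * (b * 1#)
  +-identityʳ-lemma a b = begin
    (a * 1# + 0# * b) * b ≈⟨ *-congʳ (trans (+-cong (*-identityʳ a) (zeroˡ b)) (+-identityʳ a)) ⟩
    a * b                 ≈⟨ *-congˡ (*-identityʳ b) ⟨
    a * (b * 1#)          ∎

  inverseʳ-lemma : ∀ a b → (a * b + - a * b) * 1# ≈ 0# * (b * b)
  inverseʳ-lemma a b = begin
    (a * b + - a * b) * 1# ≈⟨ *-identityʳ _ ⟩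
    a * b + - a * b        ≈⟨ +-congˡ (-‿distribˡ-* a b) ⟨
    a * b - a * b          ≈⟨ -‿inverseʳ _ ⟩
    0#                     ≈⟨ zeroˡ _ ⟨
    0# * (b * b)           ∎

  *-assoc-lemma : ∀ a b c d e f → (a * c * e) * (b * (d * f)) ≈ (a * (c * e)) * (b * d * f)
  *-assoc-lemma = solve 6 (λ a b c d e f → (a :* c :* e) :* (b :* (d :* f)) := (a :* (c :* e)) :* (b :* d :* f)) refl

  *-comm-lemma : ∀ a b c d → (a * c) * (d * b) ≈ (c * a) * (b * d)
  *-comm-lemma = solve 4 (λ a b c d → (a :* c) :* (d :* b) := (c :* a) :* (b :* d)) refl

  *-identityˡ-lemma : ∀ a b → (1# * a) * b ≈ a * (1# * b)
  *-identityˡ-lemma a b = begin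
    (1# * a) * b ≈⟨ *-congʳ (*-identityˡ a) ⟩
    a * b        ≈⟨ *-congˡ (*-identityˡ b) ⟨
    a * (1# * b) ∎

  distribʳ-lemma : ∀ a b c d e f →
    ((a * d + c * b) * e) * ((b * f) * (d * f)) ≈ ((a * e) * (d * f) + (c * e) * (b * f)) * ((b * d) * f)
  distribʳ-lemma = solve 6 (λ a b c d e f →
    ((a :* d :+ c :* b) :* e) :* ((b :* f) :* (d :* f)) := ((a :* e) :* (d :* f) :+ (c :* e) :* (b :* f)) :* ((b :* d) :* f)) refl

  inverse-lemma : ∀ a b → (a * b) * 1# ≈ 1# * (b * a)
  inverse-lemma a b = begin
    (a * b) * 1# ≈⟨ *-identityʳ _ ⟩
    a * b        ≈⟨ *-comm a b ⟩
    b * a        ≈⟨ *-identityˡ _ ⟨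
    1# * (b * a) ∎

module _ where

  open CommutativeRing ℚ[q]-commutativeRing
  open RingProperties ring using (x∙y⁻¹≈ε⇒x≈y)

  -- If p - s were nonzero, its product with d would be nonzero too. Decidability of `Nonzero` makes
  -- the case distinction constructive.
  *-cancelʳ-Nonzero : ∀ {d} → Poly.Nonzero d → ∀ p s → p * d ≈ s * d → p ≈ s
  *-cancelʳ-Nonzero {d} d≢0 p s pd≈sd with Poly.nonzero? (p - s)
  ... | yes p-s≢0 = contradiction (FracIdentities.difference-lemma ℚ[q]-commutativeRing {d} {p} {s} pd≈sd)
                                  (Nonzero⇒≉0 (Poly.*-nonzero p-s≢0 d≢0))
  ... | no  p-s≡0 = x∙y⁻¹≈ε⇒x≈y p s (¬Nonzero⇒≈0 (p - s) p-s≡0)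

module _ where
  open ℚ⟨q⟩
  open Frac
  open FracIdentities ℚ[q]-commutativeRing
  private module P = CommutativeRing ℚ[q]-commutativeRing

  ≈-trans-Frac : ∀ {x y w} → x ≈ y → y ≈ w → x ≈ w
  ≈-trans-Frac {x} {y} {w} p s = *-cancelʳ-Nonzero (den≢0 y) (num x Poly.* den w) (num w Poly.* den x)
    (trans-lemma {num x} {den x} {num y} {den y} {num w} {den w} p s)

  *-comm-Frac : ∀ x y → x * y ≈ y * x
  *-comm-Frac x y = *-comm-lemma (num x) (den x) (num y) (den y)

  +-comm-Frac : ∀ x y → x + y ≈ y + x
  +-comm-Frac x y = +-comm-lemma (num x) (den x) (num y) (den y)

  +-cong-Frac : ∀ {x x′ y y′} → x ≈ x′ → y ≈ y′ → x + y ≈ x′ + y′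
  +-cong-Frac {x} {x′} {y} {y′} = +-cong-lemma {num x} {den x} {num y} {den y} {num x′} {den x′} {num y′} {den y′}

  *-distribʳ-Frac : ∀ w x y → (x + y) * w ≈ x * w + y * w
  *-distribʳ-Frac w x y = distribʳ-lemma (num x) (den x) (num y) (den y) (num w) (den w)

  ℚ⟨q⟩-commutativeRing : CommutativeRing 0ℓ 0ℓ
  ℚ⟨q⟩-commutativeRing = record
    { Carrier = ℚ⟨q⟩
    ; _≈_     = _≈_
    ; _+_     = _+_
    ; _*_     = _*_
    ; -_      = -_
    ; 0#      = fromPoly []
    ; 1#      = fromPoly (1ℚ ∷ [])
    ; isCommutativeRing = record
      { isRing = record
        { +-isAbelianGroup = record
          { isGroup = record
            { isMonoid = record
              { isSemigroup = record
                { isMagma = record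
                  { isEquivalence = record
                    { refl  = λ k → ≡.refl
                    ; sym   = λ p k → ≡.sym (p k)
                    ; trans = λ {x} {y} {w} → ≈-trans-Frac {x} {y} {w}
                    }
                  ; ∙-cong = λ {x} {x′} {y} {y′} → +-cong-Frac {x} {x′} {y} {y′}
                  }
                ; assoc = λ x y w → +-assoc-lemma (num x) (den x) (num y) (den y) (num w) (den w)
                }
              ; identity = (λ x → ≈-trans-Frac {fromPoly [] + x} {x + fromPoly []} {x} (+-comm-Frac (fromPoly []) x) (+-id x))
                         , +-id
              }
            ; inverse = (λ x → ≈-trans-Frac {(- x) + x} {x + (- x)} {fromPoly []} (+-comm-Frac (- x) x) (+-inv x))
                      , +-inv
            ; ⁻¹-cong = λ {x} {y} → neg-cong-lemma {num x} {den x} {num y} {den y}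
            }
          ; comm = +-comm-Frac
          }
        ; *-cong     = λ {x} {x′} {y} {y′} → *-cong-lemma {num x} {den x} {num y} {den y} {num x′} {den x′} {num y′} {den y′}
        ; *-assoc    = λ x y w → *-assoc-lemma (num x) (den x) (num y) (den y) (num w) (den w)
        ; *-identity = *-id
                     , λ x → ≈-trans-Frac {x * fromPoly (1ℚ ∷ [])} {fromPoly (1ℚ ∷ []) * x} {x} (*-comm-Frac x (fromPoly (1ℚ ∷ []))) (*-id x)
        ; distrib    = (λ w x y → ≈-trans-Frac {w * (x + y)} {(x + y) * w} {w * x + w * y} (*-comm-Frac w (x + y))
                         (≈-trans-Frac {(x + y) * w} {x * w + y * w} {w * x + w * y} (*-distribʳ-Frac w x y)
                           (+-cong-Frac {x * w} {w * x} {y * w} {w * y} (*-comm-Frac x w) (*-comm-Frac y w))))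
                     , *-distribʳ-Frac
        }
      ; *-comm = *-comm-Frac
      }
    }
    where
    +-id : ∀ x → x + fromPoly [] ≈ x
    +-id x = +-identityʳ-lemma (num x) (den x)
    +-inv : ∀ x → x + (- x) ≈ fromPoly []
    +-inv x = inverseʳ-lemma (num x) (den x)
    *-id : ∀ x → fromPoly (1ℚ ∷ []) * x ≈ x
    *-id x = *-identityˡ-lemma (num x) (den x)

  ⁻¹-inverseʳ : ∀ x → ¬ x ≈ fromPoly [] → x * x ⁻¹ ≈ fromPoly (1ℚ ∷ [])
  ⁻¹-inverseʳ x x≉0 with Poly.nonzero? (num x)
  ... | yes num≢0 = inverse-lemma (num x) (den x)
  ... | no  num≡0 = contradiction (P.trans {num x P.* P.1#} {num x} {P.0#} (P.*-identityʳ (num x)) (¬Nonzero⇒≈0 (num x) num≡0)) x≉0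

  1≉0-Frac : ¬ fromPoly (1ℚ ∷ []) ≈ fromPoly []
  1≉0-Frac p with () ← p 0

  -- With denominators cleared, the constant coefficients of the two sides are 1 and 0.
  1-q≉0 : ¬ fromPoly (1ℚ ∷ []) + (- q) ≈ fromPoly []
  1-q≉0 p with () ← p 0

-- The order on the symbols

≺-irrefl : ∀ {r n} {x : Symbol r n} → ¬ x ≺ x
≺-irrefl (value v<v)  = Fin.<-irrefl ≡.refl v<v
≺-irrefl (colour c<c) = Fin.<-irrefl ≡.refl c<c
≺-irrefl (un≺un v<v)  = Fin.<-irrefl ≡.refl v<v

≺-trans : ∀ {r n} {x y w : Symbol r n} → x ≺ y → y ≺ w → x ≺ w
≺-trans (value p)  (value q)  = value (Fin.<-trans q p)
≺-trans (value p)  (colour q) = value p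
≺-trans (value p)  col≺𝟎      = col≺𝟎
≺-trans (value p)  col≺un     = col≺un
≺-trans (colour p) (value q)  = value q
≺-trans (colour p) (colour q) = colour (Fin.<-trans q p)
≺-trans (colour p) col≺𝟎      = col≺𝟎
≺-trans (colour p) col≺un     = col≺un
≺-trans col≺𝟎      𝟎≺un       = col≺un
≺-trans col≺un     (un≺un q)  = col≺un
≺-trans 𝟎≺un       (un≺un q)  = 𝟎≺un
≺-trans (un≺un p)  (un≺un q)  = un≺un (Fin.<-trans p q)

≺-asym : ∀ {r n} {x y : Symbol r n} → x ≺ y → ¬ y ≺ x
≺-asym p q = ≺-irrefl (≺-trans p q)

≺⇒tri< : ∀ {r n} {x y : Symbol r n} → x ≺ y → Tri (x ≺ y) (x ≡ y) (y ≺ x)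
≺⇒tri< p = tri< p (λ { ≡.refl → ≺-irrefl p }) (≺-asym p)

≻⇒tri> : ∀ {r n} {x y : Symbol r n} → y ≺ x → Tri (x ≺ y) (x ≡ y) (y ≺ x)
≻⇒tri> p = tri> (≺-asym p) (λ { ≡.refl → ≺-irrefl p }) p

≺-cmp : ∀ {r n} → Trichotomous _≡_ (_≺_ {r} {n})
≺-cmp 𝟎           𝟎           = tri≈ ≺-irrefl ≡.refl ≺-irrefl
≺-cmp 𝟎           (w ↑ zero)  = ≺⇒tri< 𝟎≺un
≺-cmp 𝟎           (w ↑ suc d) = ≻⇒tri> col≺𝟎
≺-cmp (v ↑ zero)  𝟎           = ≻⇒tri> 𝟎≺un
≺-cmp (v ↑ suc c) 𝟎           = ≺⇒tri< col≺𝟎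
≺-cmp (v ↑ zero)  (w ↑ suc d) = ≻⇒tri> col≺un
≺-cmp (v ↑ suc c) (w ↑ zero)  = ≺⇒tri< col≺un
≺-cmp (v ↑ zero)  (w ↑ zero) with Fin.<-cmp v w
... | tri< v<w _ _    = ≺⇒tri< (un≺un v<w)
... | tri≈ _ ≡.refl _ = tri≈ ≺-irrefl ≡.refl ≺-irrefl
... | tri> _ _ w<v    = ≻⇒tri> (un≺un w<v)
≺-cmp (v ↑ suc c) (w ↑ suc d) with Fin.<-cmp v w | Fin.<-cmp c d
... | tri< v<w _ _    | _               = ≻⇒tri> (value v<w)
... | tri> _ _ w<v    | _               = ≺⇒tri< (value w<v)
... | tri≈ _ ≡.refl _ | tri< c<d _ _    = ≻⇒tri> (colour c<d)
... | tri≈ _ ≡.refl _ | tri≈ _ ≡.refl _ = tri≈ ≺-irrefl ≡.refl ≺-irrefl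
... | tri≈ _ ≡.refl _ | tri> _ _ d<c    = ≺⇒tri< (colour d<c)

Letter : ℕ → ℕ → Set
Letter r n = Fin n × Fin r

⌊_⌋ : ∀ {r n} → Letter r n → Symbol r n
⌊ v , c ⌋ = v ↑ c

infix 4 _⊏_
_⊏_ : ∀ {r n} → Letter r n → Letter r n → Set
x ⊏ y = ⌊ x ⌋ ≺ ⌊ y ⌋

⌊⌋-injective : ∀ {r n} {x y : Letter r n} → ⌊ x ⌋ ≡ ⌊ y ⌋ → x ≡ y
⌊⌋-injective ≡.refl = ≡.refl

⊏-strictTotalOrder : ℕ → ℕ → StrictTotalOrder 0ℓ 0ℓ 0ℓ
⊏-strictTotalOrder r n = record
  { Carrier = Letter r n
  ; _≈_ = _≡_
  ; _<_ = _⊏_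
  ; isStrictTotalOrder = record
    { isStrictPartialOrder = record
      { isEquivalence = ≡.isEquivalence
      ; irrefl        = λ { ≡.refl → ≺-irrefl }
      ; trans         = ≺-trans
      ; <-resp-≈      = (λ { ≡.refl p → p }) , (λ { ≡.refl p → p })
      }
    ; compare = cmp
    }
  }
  where
  cmp : Trichotomous _≡_ (_⊏_ {r} {n})
  cmp x y with ≺-cmp ⌊ x ⌋ ⌊ y ⌋
  ... | tri< p q s = tri< p (q ∘ ≡.cong ⌊_⌋) s
  ... | tri≈ p q s = tri≈ p (⌊⌋-injective q) s
  ... | tri> p q s = tri> p (q ∘ ≡.cong ⌊_⌋) s

letters : ∀ r n → List (Letter r n)
letters r n = List.cartesianProduct (List.allFin n) (List.allFin r)

-- Telescoping has to follow ≺, whereas `letters` runs by value and then by colour. Sorting alone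
-- gives the weak order; the absence of repetitions makes it strict.
letters-sorted : ∀ r n → ∃ λ ℓ → ℓ ↭ letters r n × AllPairs _⊏_ ℓ
letters-sorted r n = sort ℓ₀ , sort-↭ ℓ₀ , strict (Linked.Linked⇒AllPairs ≤-trans (sort-↗ ℓ₀))
    (↭ₛ.Unique-resp-↭ (≡.setoid (Letter r n)) (↭⇒↭ₛ (↭-sym (sort-↭ ℓ₀)))
      (Unique.cartesianProduct⁺ (Unique.allFin⁺ n) (Unique.allFin⁺ r)))
  where
  module O = StrictTotalOrderProperties (⊏-strictTotalOrder r n)
  open Sort O.decTotalOrder using (sort; sort-↭; sort-↗)
  ℓ₀ = letters r n
  ≤-trans = DecTotalOrder.trans O.decTotalOrder
  strict : ∀ {ℓ} → AllPairs (DecTotalOrder._≤_ O.decTotalOrder) ℓ → AllPairs _≢_ ℓ → AllPairs _⊏_ ℓ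
  strict ps qs = AllPairs.zipWith (λ { (inj₁ x<y , _) → x<y ; (inj₂ x≡y , x≢y) → contradiction x≡y x≢y }) (ps , qs)

-- Finite sums and products

module Sums (R : CommutativeRing 0ℓ 0ℓ) where

  open CommutativeRing R hiding (zero)
  open SetoidReasoning setoid
  open Solver commutativeSemiring using (solve; _:=_; _:+_; _:*_)

  infixl 5 _when_
  _when_ : Carrier → Bool → Carrier
  x when b = if b then x else 0#

  when-cong : ∀ b {x y} → x ≈ y → (x when b) ≈ (y when b)
  when-cong false x≈y = refl
  when-cong true  x≈y = x≈y

  when-≡ : ∀ {b b′} x → b ≡ b′ → (x when b) ≈ (x when b′)
  when-≡ x ≡.refl = refl

  *-when : ∀ a x b → a * (x when b) ≈ (a * x when b)
  *-when a x false = zeroʳ a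
  *-when a x true  = refl

  +-when : ∀ x y b → (x when b) + (y when b) ≈ (x + y when b)
  +-when x y false = +-identityˡ 0#
  +-when x y true  = refl

  when-when : ∀ x b c → ((x when b) when c) ≈ (x when c ∧ b)
  when-when x b false = refl
  when-when x b true  = refl

  ∑ : ∀ {A : Set} → List A → (A → Carrier) → Carrier
  ∑ xs f = List.foldr _+_ 0# (List.map f xs)

  private variable A C : Set

  ∑-congᴬ : ∀ {f g : A → Carrier} {xs} → All (λ x → f x ≈ g x) xs → ∑ xs f ≈ ∑ xs g
  ∑-congᴬ []       = refl
  ∑-congᴬ (p ∷ ps) = +-cong p (∑-congᴬ ps)

  ∑-cong : ∀ {f g : A → Carrier} xs → (∀ x → f x ≈ g x) → ∑ xs f ≈ ∑ xs g
  ∑-cong xs f≈g = ∑-congᴬ (All.universal f≈g xs)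

  ∑-+ : ∀ (f g : A → Carrier) xs → ∑ xs f + ∑ xs g ≈ ∑ xs (λ x → f x + g x)
  ∑-+ f g []       = +-identityˡ 0#
  ∑-+ f g (x ∷ xs) = begin
    (f x + ∑ xs f) + (g x + ∑ xs g)
      ≈⟨ solve 4 (λ a b c d → (a :+ b) :+ (c :+ d) := (a :+ c) :+ (b :+ d)) refl _ _ _ _ ⟩
    (f x + g x) + (∑ xs f + ∑ xs g)
      ≈⟨ +-congˡ (∑-+ f g xs) ⟩
    ∑ (x ∷ xs) (λ x → f x + g x) ∎

  ∑-* : ∀ a (f : A → Carrier) xs → a * ∑ xs f ≈ ∑ xs (λ x → a * f x)
  ∑-* a f []       = zeroʳ a
  ∑-* a f (x ∷ xs) = trans (distribˡ _ _ _) (+-congˡ (∑-* a f xs))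

  ∑-zero : ∀ (xs : List A) → ∑ xs (λ _ → 0#) ≈ 0#
  ∑-zero []       = refl
  ∑-zero (x ∷ xs) = trans (+-identityˡ _) (∑-zero xs)

  ∑-when : ∀ (f : A → Carrier) b xs → (∑ xs f when b) ≈ ∑ xs (λ x → f x when b)
  ∑-when f true  xs = refl
  ∑-when f false xs = sym (∑-zero xs)

  ∑-swap : ∀ (f : A → C → Carrier) xs ys →
    ∑ xs (λ x → ∑ ys (f x)) ≈ ∑ ys (λ y → ∑ xs (λ x → f x y))
  ∑-swap f []       ys = sym (∑-zero ys)
  ∑-swap f (x ∷ xs) ys = trans (+-congˡ (∑-swap f xs ys)) (∑-+ _ _ ys)

  ∑-++ : ∀ (f : A → Carrier) xs ys → ∑ (xs List.++ ys) f ≈ ∑ xs f + ∑ ys f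
  ∑-++ f []       ys = sym (+-identityˡ _)
  ∑-++ f (x ∷ xs) ys = trans (+-congˡ (∑-++ f xs ys)) (sym (+-assoc _ _ _))

  ∑-map : ∀ (f : C → Carrier) (g : A → C) xs → ∑ (List.map g xs) f ≡ ∑ xs (f ∘ g)
  ∑-map f g xs = ≡.cong (List.foldr _+_ 0#) (≡.sym (List.map-∘ xs))

  ∑-concatMap : ∀ (f : C → Carrier) (g : A → List C) xs →
    ∑ (List.concatMap g xs) f ≈ ∑ xs (λ x → ∑ (g x) f)
  ∑-concatMap f g []       = refl
  ∑-concatMap f g (x ∷ xs) = trans (∑-++ f (g x) _) (+-congˡ (∑-concatMap f g xs))

  ∑-cartesianProductWith : ∀ {D : Set} (f : D → Carrier) (g : A → C → D) xs ys →
    ∑ (List.cartesianProductWith g xs ys) f ≈ ∑ xs (λ x → ∑ ys (λ y → f (g x y)))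
  ∑-cartesianProductWith f g []       ys = refl
  ∑-cartesianProductWith f g (x ∷ xs) ys = trans (∑-++ f (List.map (g x) ys) _)
    (+-cong (reflexive (∑-map f (g x) ys)) (∑-cartesianProductWith f g xs ys))

  ∑-↭ : ∀ (f : A → Carrier) {xs ys} → xs ↭ ys → ∑ xs f ≈ ∑ ys f
  ∑-↭ f ↭.refl        = refl
  ∑-↭ f (prep x p)    = +-congˡ (∑-↭ f p)
  ∑-↭ f (swap x y p)  = trans
    (solve 3 (λ a b c → a :+ (b :+ c) := b :+ (a :+ c)) refl _ _ _) (+-congˡ (+-congˡ (∑-↭ f p)))
  ∑-↭ f (↭.trans p s) = trans (∑-↭ f p) (∑-↭ f s)

  ∑-filter : ∀ {P : A → Set} (P? : ∀ x → Dec (P x)) (f : A → Carrier) xs →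
    ∑ (List.filter P? xs) f ≈ ∑ xs (λ x → f x when does (P? x))
  ∑-filter P? f []       = refl
  ∑-filter P? f (x ∷ xs) with does (P? x)
  ... | true  = +-congˡ (∑-filter P? f xs)
  ... | false = trans (∑-filter P? f xs) (sym (+-identityˡ _))

  ∑-allFin-suc : ∀ {n} (f : Fin (suc n) → Carrier) →
    ∑ (List.allFin (suc n)) f ≡ f zero + ∑ (List.allFin n) (f ∘ suc)
  ∑-allFin-suc {n} f = ≡.cong (f zero +_) (≡.trans
    (≡.cong (λ xs → ∑ xs f) (≡.sym (List.map-tabulate id suc))) (∑-map f suc (List.allFin n)))

  ∑-allFin-≟ : ∀ {n} (f : Fin n → Carrier) v →
    ∑ (List.allFin n) (λ i → f i when does (i Fin.≟ v)) ≈ f v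
  ∑-allFin-≟ {suc n} f zero = begin
    _ ≡⟨ ∑-allFin-suc {n} _ ⟩
    f zero + ∑ (List.allFin n) (λ _ → 0#) ≈⟨ +-congˡ (∑-zero (List.allFin n)) ⟩
    f zero + 0#                           ≈⟨ +-identityʳ _ ⟩
    f zero                                ∎
  ∑-allFin-≟ {suc n} f (suc v) = begin
    _ ≡⟨ ∑-allFin-suc {n} _ ⟩
    0# + ∑ (List.allFin n) (λ i → f (suc i) when does (i Fin.≟ v)) ≈⟨ +-identityˡ _ ⟩
    ∑ (List.allFin n) (λ i → f (suc i) when does (i Fin.≟ v)) ≈⟨ ∑-allFin-≟ (f ∘ suc) v ⟩
    f (suc v) ∎

  ∏ : ∀ {n} → Subset n → (Fin n → Carrier) → Carrier
  ∏ []          f = 1#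
  ∏ (true  ∷ S) f = f zero * ∏ S (f ∘ suc)
  ∏ (false ∷ S) f = ∏ S (f ∘ suc)

  ∏-cong : ∀ {n} (S : Subset n) {f g : Fin n → Carrier} → (∀ i → f i ≈ g i) → ∏ S f ≈ ∏ S g
  ∏-cong []          f≈g = refl
  ∏-cong (true  ∷ S) f≈g = *-cong (f≈g zero) (∏-cong S (f≈g ∘ suc))
  ∏-cong (false ∷ S) f≈g = ∏-cong S (f≈g ∘ suc)

  open RawSemiringDefs (RawRing.rawSemiring rawRing) using (_^_)

  ∏-const : ∀ {n} (S : Subset n) a → ∏ S (λ _ → a) ≈ a ^ ∣ S ∣
  ∏-const []          a = refl
  ∏-const (true  ∷ S) a = *-congˡ (∏-const S a)
  ∏-const (false ∷ S) a = ∏-const S a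

  ∏-skip : ∀ {n} (S : Subset n) i → lookup S i ≡ false → ∀ {f g : Fin n → Carrier} →
    (∀ j → i ≢ j → f j ≈ g j) → ∏ S f ≈ ∏ S g
  ∏-skip (false ∷ S) zero    _   f≈g = ∏-cong S (λ j → f≈g (suc j) λ ())
  ∏-skip (false ∷ S) (suc i) i∉S f≈g = ∏-skip S i i∉S (λ j i≢j → f≈g (suc j) (i≢j ∘ Fin.suc-injective))
  ∏-skip (true  ∷ S) (suc i) i∉S f≈g =
    *-cong (f≈g zero λ ()) (∏-skip S i i∉S (λ j i≢j → f≈g (suc j) (i≢j ∘ Fin.suc-injective)))

  -- The product is linear in its i-th factor: the part d is pulled out and leaves the product over
  -- the other indices.
  ∏-step : ∀ {n} (S : Subset n) i → lookup S i ≡ true → ∀ {f g : Fin n → Carrier} d →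
    f i ≈ d + g i → (∀ j → i ≢ j → f j ≈ g j) → ∏ S f ≈ d * ∏ (S [ i ]≔ false) g + ∏ S g
  ∏-step (true ∷ S) zero _ {f} {g} d fᵢ f≈g = begin
    f zero * ∏ S (f ∘ suc)                        ≈⟨ *-cong fᵢ (∏-cong S (λ j → f≈g (suc j) λ ())) ⟩
    (d + g zero) * ∏ S (g ∘ suc)                  ≈⟨ distribʳ _ _ _ ⟩
    d * ∏ S (g ∘ suc) + g zero * ∏ S (g ∘ suc)    ∎
  ∏-step (true ∷ S) (suc i) i∈S {f} {g} d fᵢ f≈g = begin
    f zero * ∏ S (f ∘ suc)
      ≈⟨ *-cong (f≈g zero λ ()) (∏-step S i i∈S d fᵢ (λ j i≢j → f≈g (suc j) (i≢j ∘ Fin.suc-injective))) ⟩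
    g zero * (d * ∏ (S [ i ]≔ false) (g ∘ suc) + ∏ S (g ∘ suc))
      ≈⟨ solve 4 (λ a d x y → a :* (d :* x :+ y) := d :* (a :* x) :+ a :* y) refl (g zero) d _ _ ⟩
    d * (g zero * ∏ (S [ i ]≔ false) (g ∘ suc)) + g zero * ∏ S (g ∘ suc) ∎
  ∏-step (false ∷ S) (suc i) i∈S d fᵢ f≈g =
    ∏-step S i i∈S d fᵢ (λ j i≢j → f≈g (suc j) (i≢j ∘ Fin.suc-injective))

∣S∣-remove : ∀ {n} (S : Subset n) i → lookup S i ≡ true → ∣ S ∣ ≡ suc ∣ S [ i ]≔ false ∣
∣S∣-remove (true  ∷ S) zero    _   = ≡.refl
∣S∣-remove (true  ∷ S) (suc i) i∈S = ≡.cong suc (∣S∣-remove S i i∈S)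
∣S∣-remove (false ∷ S) (suc i) i∈S = ∣S∣-remove S i i∈S

above : ∀ {r n} → Symbol r n → List (Letter r n) → List (Letter r n)
above x = List.filter (λ y → x ≺? ⌊ y ⌋)

above-above : ∀ {r n} {x : Symbol r n} ℓ {y} → x ≺ ⌊ y ⌋ → above ⌊ y ⌋ (above x ℓ) ≡ above ⌊ y ⌋ ℓ
above-above []      x<y = ≡.refl
above-above {x = x} (w ∷ ℓ) {y} x<y with x ≺? ⌊ w ⌋
... | no x≮w = ≡.trans (above-above ℓ x<y)
                 (≡.sym (List.filter-reject (λ w → ⌊ y ⌋ ≺? ⌊ w ⌋) (x≮w ∘ ≺-trans x<y)))
... | yes x<w with does (⌊ y ⌋ ≺? ⌊ w ⌋)
...   | true  = ≡.cong (w ∷_) (above-above ℓ x<y)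
...   | false = above-above ℓ x<y

-- Telescoping along the alphabet

module Telescope (R : CommutativeRing 0ℓ 0ℓ) {r n : ℕ} (B : CommutativeRing.Carrier R)
                 (ω : Letter r n → CommutativeRing.Carrier R) where

  open CommutativeRing R hiding (zero)
  open RawSemiringDefs (RawRing.rawSemiring rawRing) using (_^_)
  open SetoidReasoning setoid
  open Sums R

  -- Total weight of the choices open to the value v: B for all lower levels together, and ω y for
  -- each letter y of ℓ that carries v at the current level.
  factor : List (Letter r n) → Fin n → Carrier
  factor ℓ v = B + ∑ ℓ (λ y → ω y when does (proj₁ y Fin.≟ v))

  T : List (Letter r n) → Subset n → Carrier
  T ℓ S = ∏ S (factor ℓ)

  T-↭ : ∀ {ℓ ℓ′} → ℓ ↭ ℓ′ → ∀ S → T ℓ S ≈ T ℓ′ S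
  T-↭ p S = ∏-cong S λ v → +-congˡ (∑-↭ _ p)

  -- A new letter y changes only the factor of its own value, so the increment is ω y times the
  -- product over the remaining values.
  T-∷ : ∀ y ℓ S → T (y ∷ ℓ) S ≈ (ω y * T ℓ (S [ proj₁ y ]≔ false) when lookup S (proj₁ y)) + T ℓ S
  T-∷ y ℓ S with lookup S (proj₁ y) in eq
  ... | false = trans (∏-skip S (proj₁ y) eq other) (sym (+-identityˡ _))
    where
    other : ∀ v → proj₁ y ≢ v → factor (y ∷ ℓ) v ≈ factor ℓ v
    other v y≢v rewrite dec-false (proj₁ y Fin.≟ v) y≢v = +-congˡ (+-identityˡ _)
  ... | true  = ∏-step S (proj₁ y) eq (ω y) this other
    where
    other : ∀ v → proj₁ y ≢ v → factor (y ∷ ℓ) v ≈ factor ℓ v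
    other v y≢v rewrite dec-false (proj₁ y Fin.≟ v) y≢v = +-congˡ (+-identityˡ _)
    this : factor (y ∷ ℓ) (proj₁ y) ≈ ω y + factor ℓ (proj₁ y)
    this rewrite dec-true (proj₁ y Fin.≟ proj₁ y) ≡.refl =
      trans (sym (+-assoc _ _ _)) (trans (+-congʳ (+-comm _ _)) (+-assoc _ _ _))

  -- Contribution of the functions whose first letter is y at the current level: the value of y is
  -- used up and all other values take letters after y.
  first : List (Letter r n) → Subset n → Letter r n → Carrier
  first ℓ S y = ω y * T (above ⌊ y ⌋ ℓ) (S [ proj₁ y ]≔ false) when lookup S (proj₁ y)

  first-≡ : ∀ ℓ ℓ′ S y → above ⌊ y ⌋ ℓ ≡ above ⌊ y ⌋ ℓ′ → first ℓ S y ≈ first ℓ′ S y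
  first-≡ ℓ ℓ′ S y p = reflexive (≡.cong (λ ℓ → ω y * T ℓ (S [ proj₁ y ]≔ false) when lookup S (proj₁ y)) p)

  -- Letters are removed from the front, and each removal costs exactly the functions starting with
  -- that letter. What remains, `B ^ ∣ S ∣`, counts the functions with no letter on the current
  -- level.
  telescope-sorted : ∀ {ℓ} → AllPairs _⊏_ ℓ → ∀ S → T ℓ S ≈ ∑ ℓ (first ℓ S) + B ^ ∣ S ∣
  telescope-sorted [] S = begin
    ∏ S (λ _ → B + 0#)   ≈⟨ ∏-cong S (λ _ → +-identityʳ B) ⟩
    ∏ S (λ _ → B)        ≈⟨ ∏-const S B ⟩
    B ^ ∣ S ∣            ≈⟨ +-identityˡ _ ⟨
    0# + B ^ ∣ S ∣       ∎
  telescope-sorted {y ∷ ℓ} (y<ℓ ∷ ℓ↗) S = begin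
    T (y ∷ ℓ) S
      ≈⟨ T-∷ y ℓ S ⟩
    (ω y * T ℓ (S [ proj₁ y ]≔ false) when lookup S (proj₁ y)) + T ℓ S
      ≈⟨ +-cong (reflexive (≡.cong (λ ℓ → ω y * T ℓ (S [ proj₁ y ]≔ false) when lookup S (proj₁ y)) (≡.sym above-y)))
                (telescope-sorted ℓ↗ S) ⟩
    first (y ∷ ℓ) S y + (∑ ℓ (first ℓ S) + B ^ ∣ S ∣)
      -- The smallest letter y is above no later y′, so adding it back leaves `first` at y′
      -- unchanged.
      ≈⟨ +-congˡ (+-congʳ (∑-congᴬ (All.map (λ {y′} y<y′ →
           first-≡ ℓ (y ∷ ℓ) S y′ (≡.sym (List.filter-reject (λ x → ⌊ y′ ⌋ ≺? ⌊ x ⌋) (≺-asym y<y′)))) y<ℓ))) ⟩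
    first (y ∷ ℓ) S y + (∑ ℓ (first (y ∷ ℓ) S) + B ^ ∣ S ∣)
      ≈⟨ +-assoc _ _ _ ⟨
    ∑ (y ∷ ℓ) (first (y ∷ ℓ) S) + B ^ ∣ S ∣ ∎
    where
    above-y : above ⌊ y ⌋ (y ∷ ℓ) ≡ ℓ
    above-y = ≡.trans (List.filter-reject (λ x → ⌊ y ⌋ ≺? ⌊ x ⌋) {y} ≺-irrefl) (List.filter-all (λ x → ⌊ y ⌋ ≺? ⌊ x ⌋) y<ℓ)

  first-↭ : ∀ {ℓ ℓ′} → ℓ ↭ ℓ′ → ∀ S y → first ℓ S y ≈ first ℓ′ S y
  first-↭ p S y = when-cong (lookup S (proj₁ y)) (*-congˡ (T-↭ (↭.filter-↭ _ p) (S [ proj₁ y ]≔ false)))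

  telescope : ∀ S → T (letters r n) S ≈ ∑ (letters r n) (first (letters r n) S) + B ^ ∣ S ∣
  telescope S with ℓ , p , ℓ↗ ← letters-sorted r n = begin
    T (letters r n) S                                     ≈⟨ T-↭ p S ⟨
    T ℓ S                                                 ≈⟨ telescope-sorted ℓ↗ S ⟩
    ∑ ℓ (first ℓ S) + B ^ ∣ S ∣                           ≈⟨ +-congʳ (∑-cong ℓ (first-↭ p S)) ⟩
    ∑ ℓ (first (letters r n) S) + B ^ ∣ S ∣               ≈⟨ +-congʳ (∑-↭ _ p) ⟩
    ∑ (letters r n) (first (letters r n) S) + B ^ ∣ S ∣   ∎

  telescope-above : ∀ x S → T (above x (letters r n)) S ≈
    ∑ (letters r n) (λ y → first (letters r n) S y when does (x ≺? ⌊ y ⌋)) + B ^ ∣ S ∣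
  telescope-above x S with ℓ , p , ℓ↗ ← letters-sorted r n = begin
    T (above x (letters r n)) S
      ≈⟨ T-↭ (↭.filter-↭ _ p) S ⟨
    T (above x ℓ) S
      ≈⟨ telescope-sorted (AllPairs.filter⁺ _ ℓ↗) S ⟩
    ∑ (above x ℓ) (first (above x ℓ) S) + B ^ ∣ S ∣
      -- For y above x, everything above y is already above x, so `first` may refer to the whole
      -- alphabet.
      ≈⟨ +-congʳ (∑-congᴬ (All.map (λ {y} x<y → trans (first-≡ (above x ℓ) ℓ S y (above-above ℓ x<y)) (first-↭ p S y))
                                   (All.all-filter _ ℓ))) ⟩
    ∑ (above x ℓ) (first (letters r n) S) + B ^ ∣ S ∣
      ≈⟨ +-congʳ (∑-filter (λ y → x ≺? ⌊ y ⌋) _ ℓ) ⟩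
    ∑ ℓ (λ y → first (letters r n) S y when does (x ≺? ⌊ y ⌋)) + B ^ ∣ S ∣
      ≈⟨ +-congʳ (∑-↭ _ p) ⟩
    ∑ (letters r n) (λ y → first (letters r n) S y when does (x ≺? ⌊ y ⌋)) + B ^ ∣ S ∣ ∎

-- Descents of words in the symbols

descents : ∀ {r n m} → Vec (Symbol r n) (suc m) → List (Fin m)
descents {m = m} ys =
  List.filter (λ i → lookup ys (suc i) ≺? lookup ys (inject₁ i)) (List.allFin m)

filter-map : ∀ {A C : Set} {P : C → Set} (P? : ∀ x → Dec (P x)) (f : A → C) xs →
  List.filter P? (List.map f xs) ≡ List.map f (List.filter (P? ∘ f) xs)
filter-map P? f []       = ≡.refl
filter-map P? f (x ∷ xs) with does (P? (f x))
... | true  = ≡.cong (f x ∷_) (filter-map P? f xs)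
... | false = filter-map P? f xs

filter-descents : ∀ {r n m} (x y : Symbol r n) (ys : Vec (Symbol r n) m) →
  List.filter (λ i → lookup (x ∷ y ∷ ys) (suc i) ≺? lookup (x ∷ y ∷ ys) (inject₁ i)) (List.tabulate suc)
    ≡ List.map suc (descents (y ∷ ys))
filter-descents {m = m} x y ys = ≡.trans
  (≡.cong (List.filter _) (≡.sym (List.map-tabulate id suc)))
  (filter-map (λ i → lookup (x ∷ y ∷ ys) (suc i) ≺? lookup (x ∷ y ∷ ys) (inject₁ i)) suc (List.allFin m))

des-∷ : ∀ {r n m} (x y : Symbol r n) (ys : Vec (Symbol r n) m) →
  List.length (descents (x ∷ y ∷ ys)) ≡ (if does (y ≺? x) then 1 else 0) ℕ.+ List.length (descents (y ∷ ys))
des-∷ x y ys with does (y ≺? x)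
... | true  = ≡.cong suc (≡.trans (≡.cong List.length (filter-descents x y ys)) (List.length-map suc (descents (y ∷ ys))))
... | false = ≡.trans (≡.cong List.length (filter-descents x y ys)) (List.length-map suc (descents (y ∷ ys)))

sum-suc : ∀ {m} (is : List (Fin m)) →
  ListAction.sum (List.map toℕ (List.map suc is)) ≡ ListAction.sum (List.map toℕ is) ℕ.+ List.length is
sum-suc []       = ≡.refl
sum-suc (i ∷ is) = ≡.trans (≡.cong (suc (toℕ i) ℕ.+_) (sum-suc is)) (lemma (toℕ i) _ _)
  where
  lemma : ∀ a b c → suc a ℕ.+ (b ℕ.+ c) ≡ a ℕ.+ b ℕ.+ suc c
  lemma = solve-∀

-- A descent created at the front has position 0 and adds nothing. Every other descent moves one
-- place to the right, which adds their number.
maj-∷ : ∀ {r n m} (x y : Symbol r n) (ys : Vec (Symbol r n) m) →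
  ListAction.sum (List.map toℕ (descents (x ∷ y ∷ ys)))
    ≡ ListAction.sum (List.map toℕ (descents (y ∷ ys))) ℕ.+ List.length (descents (y ∷ ys))
maj-∷ x y ys with does (y ≺? x)
... | true  = ≡.trans (≡.cong (ListAction.sum ∘ List.map toℕ) (filter-descents x y ys)) (sum-suc (descents (y ∷ ys)))
... | false = ≡.trans (≡.cong (ListAction.sum ∘ List.map toℕ) (filter-descents x y ys)) (sum-suc (descents (y ∷ ys)))

-- Words without repetition

-- Distinctness as a recursion that removes each value once used, in the shape needed to split off a
-- first letter.
valid : ∀ {n m} → Subset n → Vec (Fin n) m → Bool
valid S []      = true
valid S (v ∷ w) = lookup S v ∧ valid (S [ v ]≔ false) w

valid⇒Unique : ∀ {n m} (S : Subset n) (w : Vec (Fin n) m) → valid S w ≡ true →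
  VecAll.All (λ v → lookup S v ≡ true) w × Unique w
valid⇒Unique S []      _  = [] , []
valid⇒Unique S (v ∷ w) ok with lookup S v in v∈S
... | true with all , uniq ← valid⇒Unique (S [ v ]≔ false) w ok =
  (v∈S ∷ VecAll.map (λ {u} u∈S-v → ≡.trans (≡.sym (Vec.lookup∘update′ (≢v u∈S-v) S false)) u∈S-v) all)
  , (VecAll.map (λ u∈S-v → ≢v u∈S-v ∘ ≡.sym) all ∷ uniq)
  where
  ≢v : ∀ {u} → lookup (S [ v ]≔ false) u ≡ true → u ≢ v
  ≢v u∈S-v ≡.refl with () ← ≡.trans (≡.sym (Vec.lookup∘update v S false)) u∈S-v

Unique⇒valid : ∀ {n m} (S : Subset n) (w : Vec (Fin n) m) →
  VecAll.All (λ v → lookup S v ≡ true) w → Unique w → valid S w ≡ true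
Unique⇒valid S []      []          []           = ≡.refl
Unique⇒valid S (v ∷ w) (v∈S ∷ all) (v∉w ∷ uniq) rewrite v∈S =
  Unique⇒valid (S [ v ]≔ false) w
    (VecAll.map (λ { (u∈S , v≢u) → ≡.trans (Vec.lookup∘update′ (v≢u ∘ ≡.sym) S false) u∈S }) (VecAll.zip (all , v∉w))) uniq

distinct?-valid : ∀ {n m} (w : Vec (Fin n) m) → does (distinct? w) ≡ valid ⊤ w
distinct?-valid w with valid ⊤ w in eq
... | true  = dec-true (distinct? w) (proj₂ (valid⇒Unique ⊤ w eq))
... | false = dec-false (distinct? w) λ w! →
  contradiction (≡.trans (≡.sym eq) (Unique⇒valid ⊤ w (VecAll.universal (λ v → Vec.lookup-replicate v true) w) w!)) λ ()

-- Gives a name to the function local to G.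
colouringsOf : ∀ r n → ∃ λ f → G r n ≡ List.concatMap f (words (List.allFin n) n)
colouringsOf r n = _ , ≡.refl

-- The generating polynomial, letter by letter

module WordSums (R : CommutativeRing 0ℓ 0ℓ) (r n : ℕ) (Q : CommutativeRing.Carrier R) where

  open CommutativeRing R hiding (zero)
  open RawSemiringDefs (RawRing.rawSemiring rawRing) using (_^_)
  open Exp commutativeSemiring using (^-homo-*; ^-assocʳ; ^-distrib-*)
  open Solver commutativeSemiring using (solve; _:=_; _:*_)
  open SetoidReasoning setoid
  open Sums R

  jump : Carrier → Bool → Carrier
  jump Y b = if b then Y else 1#

  -- For x = 𝟎 and Y = Z this unfolds to the monomial of the coloured permutation in
  -- `generatingPolynomial`.
  weight : ∀ {m} → Carrier → Symbol r n → Vec (Fin n) m → Vec (Fin r) m → Carrier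
  weight Y x w cs =
    Y ^ List.length D * Q ^ (r ℕ.* ListAction.sum (List.map toℕ D) ℕ.+ Vec.sum (Vec.map toℕ cs))
    where D = descents (x ∷ Vec.zipWith _↑_ w cs)

  -- Moving each later descent one place to the right adds r to the exponent of Q per descent;
  -- replacing Y by `Y * Q ^ r` accounts for this. `jump` records the possible descent at position
  -- 0.
  weight-∷ : ∀ {m} Y x v c (w : Vec (Fin n) m) cs →
    weight Y x (v ∷ w) (c ∷ cs)
      ≈ jump Y (does ((v ↑ c) ≺? x)) * Q ^ toℕ c * weight (Y * Q ^ r) (v ↑ c) w cs
  weight-∷ Y x v c w cs = begin
    Y ^ List.length (descents (x ∷ y ∷ ys)) * Q ^ (r ℕ.* maj′ (x ∷ y ∷ ys) ℕ.+ (toℕ c ℕ.+ Σc))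
      ≡⟨ ≡.cong₂ (λ d e → Y ^ d * Q ^ (r ℕ.* e ℕ.+ (toℕ c ℕ.+ Σc))) (des-∷ x y ys) (maj-∷ x y ys) ⟩
    Y ^ ((if b then 1 else 0) ℕ.+ d) * Q ^ (r ℕ.* (M ℕ.+ d) ℕ.+ (toℕ c ℕ.+ Σc))
      ≈⟨ *-cong (trans (^-homo-* Y (if b then 1 else 0) d) (*-congʳ (Y^ b)))
                (trans (reflexive (≡.cong (Q ^_) (exponent r M d (toℕ c) Σc)))
                  (trans (^-homo-* Q (r ℕ.* d) _)
                    (*-cong (sym (^-assocʳ Q r d)) (^-homo-* Q (toℕ c) _)))) ⟩
    (jump Y b * Y ^ d) * ((Q ^ r) ^ d * (Q ^ toℕ c * Q ^ (r ℕ.* M ℕ.+ Σc)))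
      ≈⟨ solve 5 (λ j a q c e → (j :* a) :* (q :* (c :* e)) := j :* c :* ((a :* q) :* e)) refl _ _ _ _ _ ⟩
    jump Y b * Q ^ toℕ c * ((Y ^ d * (Q ^ r) ^ d) * Q ^ (r ℕ.* M ℕ.+ Σc))
      ≈⟨ *-congˡ (*-congʳ (^-distrib-* Y (Q ^ r) d)) ⟨
    jump Y b * Q ^ toℕ c * weight (Y * Q ^ r) y w cs ∎
    where
    y = v ↑ c
    ys = Vec.zipWith _↑_ w cs
    b = does (y ≺? x)
    maj′ : ∀ {m} → Vec (Symbol r n) (suc m) → ℕ
    maj′ ys = ListAction.sum (List.map toℕ (descents ys))
    d = List.length (descents (y ∷ ys))
    M = maj′ (y ∷ ys)
    Σc = Vec.sum (Vec.map toℕ cs)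
    Y^ : ∀ b → Y ^ (if b then 1 else 0) ≈ jump Y b
    Y^ true  = *-identityʳ Y
    Y^ false = refl
    exponent : ∀ r M d c s → r ℕ.* (M ℕ.+ d) ℕ.+ (c ℕ.+ s) ≡ r ℕ.* d ℕ.+ (c ℕ.+ (r ℕ.* M ℕ.+ s))
    exponent = solve-∀

  -- For m = ∣ S ∣ the valid words are exactly the arrangements of S.
  wordSum : ℕ → Carrier → Symbol r n → Subset n → Carrier
  wordSum m Y x S = ∑ (words (List.allFin n) m) λ w → ∑ (words (List.allFin r) m) (weight Y x w) when valid S w

  wordSum-zero : ∀ Y x S → wordSum 0 Y x S ≈ 1#
  wordSum-zero Y x S = begin
    1# * Q ^ (r ℕ.* 0 ℕ.+ 0) + 0# + 0#  ≈⟨ trans (+-identityʳ _) (trans (+-identityʳ _) (*-identityˡ _)) ⟩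
    Q ^ (r ℕ.* 0 ℕ.+ 0)                 ≡⟨ ≡.cong (Q ^_) (≡.trans (ℕ.+-identityʳ _) (ℕ.*-zeroʳ r)) ⟩
    1#                                  ∎

  -- Validity of a word is membership of its first value together with validity of the rest in the
  -- smaller set. Exchanging the sums brings the first colour in front of the remaining values.
  wordSum-suc : ∀ m Y x S → wordSum (suc m) Y x S ≈
    ∑ (letters r n) λ y → jump Y (does (⌊ y ⌋ ≺? x)) * Q ^ toℕ (proj₂ y)
                            * wordSum m (Y * Q ^ r) ⌊ y ⌋ (S [ proj₁ y ]≔ false)
                          when lookup S (proj₁ y)
  wordSum-suc m Y x S = begin
    wordSum (suc m) Y x S
      ≈⟨ ∑-cartesianProductWith _ _∷_ (List.allFin n) ws ⟩
    ∑ (List.allFin n) (λ v → ∑ ws λ w → ∑ (words (List.allFin r) (suc m)) (weight Y x (v ∷ w)) when valid S (v ∷ w))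
      ≈⟨ ∑-cong (List.allFin n) first-letter ⟩
    ∑ (List.allFin n) (λ v → ∑ (List.allFin r) λ c → rest (v , c))
      ≈⟨ ∑-cartesianProductWith _ _,_ (List.allFin n) (List.allFin r) ⟨
    ∑ (letters r n) rest ∎
    where
    ws = words (List.allFin n) m
    css = words (List.allFin r) m
    factor : Letter r n → Carrier
    factor y = jump Y (does (⌊ y ⌋ ≺? x)) * Q ^ toℕ (proj₂ y)
    rest : Letter r n → Carrier
    rest y = factor y * wordSum m (Y * Q ^ r) ⌊ y ⌋ (S [ proj₁ y ]≔ false) when lookup S (proj₁ y)
    first-colour : ∀ v w → ∑ (words (List.allFin r) (suc m)) (weight Y x (v ∷ w))
      ≈ ∑ (List.allFin r) λ c → factor (v , c) * ∑ css (weight (Y * Q ^ r) (v ↑ c) w)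
    first-colour v w = trans (∑-cartesianProductWith _ _∷_ (List.allFin r) css)
      (∑-cong (List.allFin r) λ c → trans (∑-cong css λ cs → weight-∷ Y x v c w cs) (sym (∑-* _ _ css)))
    first-letter : ∀ v →
      ∑ ws (λ w → ∑ (words (List.allFin r) (suc m)) (weight Y x (v ∷ w)) when valid S (v ∷ w))
        ≈ ∑ (List.allFin r) λ c → rest (v , c)
    first-letter v = begin
      ∑ ws (λ w → ∑ (words (List.allFin r) (suc m)) (weight Y x (v ∷ w)) when valid S (v ∷ w))
        ≈⟨ ∑-cong ws (λ w → trans (when-cong (valid S (v ∷ w)) (first-colour v w)) (∑-when _ (valid S (v ∷ w)) (List.allFin r))) ⟩
      ∑ ws (λ w → ∑ (List.allFin r) λ c → factor (v , c) * ∑ css (weight (Y * Q ^ r) (v ↑ c) w) when valid S (v ∷ w))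
        ≈⟨ ∑-swap _ ws (List.allFin r) ⟩
      ∑ (List.allFin r) (λ c → ∑ ws λ w → factor (v , c) * ∑ css (weight (Y * Q ^ r) (v ↑ c) w) when valid S (v ∷ w))
        ≈⟨ ∑-cong (List.allFin r) (λ c → begin
             ∑ ws (λ w → factor (v , c) * ∑ css (weight (Y * Q ^ r) (v ↑ c) w) when valid S (v ∷ w))
               ≈⟨ ∑-cong ws (λ w → trans (sym (when-when _ (valid (S [ v ]≔ false) w) (lookup S v)))
                     (when-cong (lookup S v) (sym (*-when (factor (v , c)) _ (valid (S [ v ]≔ false) w))))) ⟩
             ∑ ws (λ w → factor (v , c) * (∑ css (weight (Y * Q ^ r) (v ↑ c) w) when valid (S [ v ]≔ false) w) when lookup S v)
               ≈⟨ ∑-when _ (lookup S v) ws ⟨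
             (∑ ws (λ w → factor (v , c) * (∑ css (weight (Y * Q ^ r) (v ↑ c) w) when valid (S [ v ]≔ false) w)) when lookup S v)
               ≈⟨ when-cong (lookup S v) (∑-* _ _ ws) ⟨
             rest (v , c) ∎) ⟩
      ∑ (List.allFin r) (λ c → rest (v , c)) ∎

  generatingPolynomial-wordSum : ∀ Z → generatingPolynomial rawRing r n Z Q ≈ wordSum n Z 𝟎 ⊤
  generatingPolynomial-wordSum Z = trans (∑-concatMap _ (proj₁ (colouringsOf r n)) (words (List.allFin n) n))
    (∑-cong (words (List.allFin n) n) colourings)
    where
    monomial : ColouredPerm r n → Carrier
    monomial γ = Z ^ des γ * Q ^ fmaj γ
    colourings : ∀ w → ∑ (proj₁ (colouringsOf r n) w) monomial
      ≈ (∑ (words (List.allFin r) n) (weight Z 𝟎 w) when valid ⊤ w)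
    colourings w rewrite ≡.sym (distinct?-valid w) with distinct? w
    ... | yes w! = reflexive (∑-map monomial (λ c → ⟨ c , w , w! ⟩) (words (List.allFin r) n))
    ... | no  _  = refl

-- Comparisons without ties

≺?-swap : ∀ {r n} {x y : Symbol r n} → x ≢ y → does (x ≺? y) ≡ not (does (y ≺? x))
≺?-swap {x = x} {y} x≢y with ≺-cmp x y
... | tri< x<y _ x≯y rewrite dec-true (x ≺? y) x<y | dec-false (y ≺? x) x≯y = ≡.refl
... | tri≈ _ x≡y _ = contradiction x≡y x≢y
... | tri> x≮y _ x>y rewrite dec-false (x ≺? y) x≮y | dec-true (y ≺? x) x>y = ≡.refl

-- Excludes a tie between the previous symbol x and any letter still available, so that
-- `not (y ≺ x)` means `x ≺ y`.
Fresh : ∀ {r n} → Subset n → Symbol r n → Set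
Fresh {r} S x = ∀ (y : Letter r _) → lookup S (proj₁ y) ≡ true → x ≢ ⌊ y ⌋

Fresh-remove : ∀ {r n} (S : Subset n) (y : Letter r n) → Fresh (S [ proj₁ y ]≔ false) ⌊ y ⌋
Fresh-remove S y y∈S-y ∈S-y ≡.refl with () ← ≡.trans (≡.sym (Vec.lookup∘update (proj₁ y) S false)) ∈S-y

-- The q-numbers

module _ (K : CommutativeRing 0ℓ 0ℓ) (_⁻¹ : Op₁ (CommutativeRing.Carrier K)) where

  open CommutativeRing K

  -- Inversion is a total operation, so only its values at nonzero arguments are constrained.
  record IsFieldInverse : Set where
    field
      inverseʳ : ∀ x → ¬ x ≈ 0# → x * (x ⁻¹) ≈ 1#
      1≉0      : ¬ 1# ≈ 0#

  OneMinusNonzero : Carrier → Set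
  OneMinusNonzero q = ¬ 1# + - q ≈ 0#

  OneMinusInverts : Carrier → Set
  OneMinusInverts q = (1# + - q) * ((1# + - q) ⁻¹) ≈ 1#

module QNumbers (K : CommutativeRing 0ℓ 0ℓ) (_⁻¹ : Op₁ (CommutativeRing.Carrier K))
  (q : CommutativeRing.Carrier K)
  (1-q-inverseʳ : OneMinusInverts K _⁻¹ q)
  where

  open CommutativeRing K hiding (zero)
  open RawSemiringDefs (RawRing.rawSemiring rawRing) using (_^_)
  open Exp commutativeSemiring using (^-homo-*)
  open RingProperties ring using (-‿distribʳ-*)
  open SetoidReasoning setoid
  open Sums K

  [_] : ℕ → Carrier
  [_] = QNotation.qNumber rawRing _⁻¹ q

  [0]≈0 : [ 0 ] ≈ 0#
  [0]≈0 = trans (*-congʳ (-‿inverseʳ 1#)) (zeroˡ _)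

  [1]≈1 : [ 1 ] ≈ 1#
  [1]≈1 = trans (*-congʳ (+-congˡ (-‿cong (*-identityʳ q)))) 1-q-inverseʳ

  [+] : ∀ m j → [ m ℕ.+ j ] ≈ [ m ] + q ^ m * [ j ]
  [+] m j = begin
    (1# + - (q ^ (m ℕ.+ j))) * i
      ≈⟨ *-congʳ (+-congˡ (-‿cong (^-homo-* q m j))) ⟩
    (1# + - (a * b)) * i
      ≈⟨ *-congʳ (+-congʳ (trans (+-congˡ (-‿inverseˡ a)) (+-identityʳ 1#))) ⟨
    (1# + (- a + a) + - (a * b)) * i
      ≈⟨ *-congʳ (trans (+-congʳ (sym (+-assoc _ _ _))) (+-assoc _ _ _)) ⟩
    ((1# + - a) + (a + - (a * b))) * i
      ≈⟨ *-congʳ (+-congˡ (trans (distribˡ a 1# (- b)) (+-cong (*-identityʳ a) (sym (-‿distribʳ-* a b))))) ⟨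
    ((1# + - a) + a * (1# + - b)) * i
      ≈⟨ distribʳ _ _ _ ⟩
    (1# + - a) * i + a * (1# + - b) * i
      ≈⟨ +-congˡ (*-assoc _ _ _) ⟩
    [ m ] + a * [ j ] ∎
    where
    i = (1# + - q) ⁻¹
    a = q ^ m
    b = q ^ j

  ∑q^ : ∀ j → ∑ (List.allFin j) (λ c → q ^ toℕ c) ≈ [ j ]
  ∑q^ zero    = sym [0]≈0
  ∑q^ (suc j) = begin
    ∑ (List.allFin (suc j)) (λ c → q ^ toℕ c)    ≡⟨ ∑-allFin-suc {j} _ ⟩
    1# + ∑ (List.allFin j) (λ c → q * q ^ toℕ c) ≈⟨ +-cong [1]≈1 (trans (*-congʳ (*-identityʳ q)) (∑-* q _ (List.allFin j))) ⟨
    [ 1 ] + q ^ 1 * ∑ (List.allFin j) (λ c → q ^ toℕ c) ≈⟨ +-congˡ (*-congˡ (∑q^ j)) ⟩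
    [ 1 ] + q ^ 1 * [ j ]                        ≈⟨ [+] 1 j ⟨
    [ suc j ]                                    ∎

  -- Weights of functions by level and symbol

  module Levels (r n : ℕ) .{{_ : NonZero r}} where

    -- The letter of level k and colour c has weight q^{rk+c}. The lower levels offer each value the
    -- exponents 0, ..., rk-1, whose powers sum to [rk].
    module Tel (k : ℕ) = Telescope K {r} {n} [ r ℕ.* k ] (λ y → q ^ (r ℕ.* k) * q ^ toℕ (proj₂ y))

    W : ℕ → Symbol r n → Subset n → Carrier
    W k x = Tel.T k (above x (letters r n))

    ∑-letters : ∀ (f : Letter r n → Carrier) v →
      ∑ (letters r n) (λ y → f y when does (proj₁ y Fin.≟ v)) ≈ ∑ (List.allFin r) (λ c → f (v , c))
    ∑-letters f v = begin
      ∑ (letters r n) (λ y → f y when does (proj₁ y Fin.≟ v))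
        ≈⟨ ∑-cartesianProductWith _ _,_ (List.allFin n) (List.allFin r) ⟩
      ∑ (List.allFin n) (λ u → ∑ (List.allFin r) (λ c → f (u , c) when does (u Fin.≟ v)))
        ≈⟨ ∑-cong (List.allFin n) (λ u → ∑-when (λ c → f (u , c)) (does (u Fin.≟ v)) (List.allFin r)) ⟨
      ∑ (List.allFin n) (λ u → ∑ (List.allFin r) (λ c → f (u , c)) when does (u Fin.≟ v))
        ≈⟨ ∑-allFin-≟ _ v ⟩
      ∑ (List.allFin r) (λ c → f (v , c)) ∎

    -- Levels up to k exhaust the exponents below r(k+1), so the full sum at level k is the
    -- lower-level constant of level k+1. This links consecutive levels.
    T-letters : ∀ k S → Tel.T k (letters r n) S ≈ [ r ℕ.* suc k ] ^ ∣ S ∣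
    T-letters k S = trans (∏-cong S factor≈) (∏-const S _)
      where
      factor≈ : ∀ v → Tel.factor k (letters r n) v ≈ [ r ℕ.* suc k ]
      factor≈ v = begin
        [ r ℕ.* k ] + ∑ (letters r n) (λ y → q ^ (r ℕ.* k) * q ^ toℕ (proj₂ y) when does (proj₁ y Fin.≟ v))
          ≈⟨ +-congˡ (∑-letters _ v) ⟩
        [ r ℕ.* k ] + ∑ (List.allFin r) (λ c → q ^ (r ℕ.* k) * q ^ toℕ c)
          ≈⟨ +-congˡ (∑-* _ _ (List.allFin r)) ⟨
        [ r ℕ.* k ] + q ^ (r ℕ.* k) * ∑ (List.allFin r) (λ c → q ^ toℕ c)
          ≈⟨ +-congˡ (*-congˡ (∑q^ r)) ⟩
        [ r ℕ.* k ] + q ^ (r ℕ.* k) * [ r ]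
          ≈⟨ [+] (r ℕ.* k) r ⟨
        [ r ℕ.* k ℕ.+ r ]
          ≡⟨ ≡.cong [_] (≡.trans (ℕ.+-comm (r ℕ.* k) r) (≡.sym (ℕ.*-suc r k))) ⟩
        [ r ℕ.* suc k ] ∎

    -- Only uncoloured symbols exceed 𝟎. Matching `r` as a successor exposes colour 0, and the
    -- comparisons then compute.
    ∑-above-𝟎 : ∀ r {n} .{{_ : NonZero r}} (f : Fin r → Carrier) (v : Fin n) →
      ∑ (List.allFin r) (λ c → f c when does (𝟎 ≺? (v ↑ c))) ≈ ∑ (List.allFin r) (λ c → f c when does (toℕ c ℕ.≟ 0))
    ∑-above-𝟎 (suc r) f v = begin
      _ ≡⟨ ∑-allFin-suc {r} _ ⟩
      f zero + ∑ (List.allFin r) (λ c → 0#) ≡⟨ ∑-allFin-suc {r} _ ⟨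
      _ ∎

    ∑q^-when-≟0 : ∀ r .{{_ : NonZero r}} a → ∑ (List.allFin r) (λ c → a * q ^ toℕ c when does (toℕ c ℕ.≟ 0)) ≈ a
    ∑q^-when-≟0 (suc r) a = begin
      _                                   ≡⟨ ∑-allFin-suc {r} _ ⟩
      a * 1# + ∑ (List.allFin r) (λ _ → 0#) ≈⟨ +-cong (*-identityʳ a) (∑-zero (List.allFin r)) ⟩
      a + 0#                              ≈⟨ +-identityʳ a ⟩
      a                                   ∎

    when-comm : ∀ x b c → ((x when b) when c) ≈ ((x when c) when b)
    when-comm x false false = refl
    when-comm x false true  = refl
    when-comm x true  false = refl
    when-comm x true  true  = refl

    W-𝟎 : ∀ k S → W k 𝟎 S ≈ [ r ℕ.* k ℕ.+ 1 ] ^ ∣ S ∣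
    W-𝟎 k S = trans (∏-cong S factor≈) (∏-const S _)
      where
      t = q ^ (r ℕ.* k)
      factor≈ : ∀ v → Tel.factor k (above 𝟎 (letters r n)) v ≈ [ r ℕ.* k ℕ.+ 1 ]
      factor≈ v = begin
        [ r ℕ.* k ] + ∑ (above 𝟎 (letters r n)) (λ y → t * q ^ toℕ (proj₂ y) when does (proj₁ y Fin.≟ v))
          ≈⟨ +-congˡ (∑-filter (λ y → 𝟎 ≺? ⌊ y ⌋) _ (letters r n)) ⟩
        [ r ℕ.* k ] + ∑ (letters r n) (λ y → (t * q ^ toℕ (proj₂ y) when does (proj₁ y Fin.≟ v)) when does (𝟎 ≺? ⌊ y ⌋))
          ≈⟨ +-congˡ (∑-cong (letters r n) λ y → when-comm _ (does (proj₁ y Fin.≟ v)) (does (𝟎 ≺? ⌊ y ⌋))) ⟩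
        [ r ℕ.* k ] + ∑ (letters r n) (λ y → (t * q ^ toℕ (proj₂ y) when does (𝟎 ≺? ⌊ y ⌋)) when does (proj₁ y Fin.≟ v))
          ≈⟨ +-congˡ (∑-letters _ v) ⟩
        [ r ℕ.* k ] + ∑ (List.allFin r) (λ c → t * q ^ toℕ c when does (𝟎 ≺? (v ↑ c)))
          ≈⟨ +-congˡ (trans (∑-above-𝟎 r (λ c → t * q ^ toℕ c) v) (∑q^-when-≟0 r t)) ⟩
        [ r ℕ.* k ] + t
          ≈⟨ +-congˡ (trans (*-congˡ [1]≈1) (*-identityʳ t)) ⟨
        [ r ℕ.* k ] + t * [ 1 ]
          ≈⟨ [+] (r ℕ.* k) 1 ⟨
        [ r ℕ.* k ℕ.+ 1 ] ∎

    W-∅ : ∀ k x S → ∣ S ∣ ≡ 0 → W k x S ≈ 1#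
    W-∅ k x S = go S _
      where
      go : ∀ {n} (S : Subset n) f → ∣ S ∣ ≡ 0 → ∏ S f ≈ 1#
      go []          f _ = refl
      go (false ∷ S) f p = go S (f ∘ suc) p

    first : ℕ → Subset n → Letter r n → Carrier
    first k = Tel.first k (letters r n)

    module _ (x : Symbol r n) (S : Subset n) (fresh : Fresh S x) where

      below : Letter r n → Bool
      below y = does (⌊ y ⌋ ≺? x)

      -- For values in S freshness rules out a tie; for the others both sides are zero.
      first-above : ∀ k y → (first k S y when does (x ≺? ⌊ y ⌋)) ≈ (first k S y when not (below y))
      first-above k y with lookup S (proj₁ y) in y∈S
      ... | true  = when-≡ _ (≺?-swap (fresh y y∈S))
      ... | false = trans (zero-when (does (x ≺? ⌊ y ⌋))) (sym (zero-when (not (below y))))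
        where
        zero-when : ∀ b → (0# when b) ≈ 0#
        zero-when true  = refl
        zero-when false = refl

      W-above : ∀ k → W k x S ≈ ∑ (letters r n) (λ y → first k S y when not (below y)) + [ r ℕ.* k ] ^ ∣ S ∣
      W-above k = trans (Tel.telescope-above k x S) (+-congʳ (∑-cong (letters r n) (first-above k)))

      W-zero : ∣ S ∣ ≢ 0 → W 0 x S ≈ ∑ (letters r n) (λ y → first 0 S y when not (below y))
      W-zero S≢0 = trans (W-above 0) (trans (+-congˡ vanish) (+-identityʳ _))
        where
        vanish : [ r ℕ.* 0 ] ^ ∣ S ∣ ≈ 0#
        vanish with ∣ S ∣
        ... | zero  = contradiction ≡.refl S≢0
        ... | suc m = trans (*-congʳ (trans (reflexive (≡.cong [_] (ℕ.*-zeroʳ r))) [0]≈0)) (zeroˡ _)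

      -- Passing from (k, x) to (k+1, x) admits the functions whose first letter lies on level k+1
      -- above x, or on level k below x.
      W-suc : ∀ k → W (suc k) x S ≈
        W k x S + ∑ (letters r n) (λ y → if below y then first k S y else first (suc k) S y)
      W-suc k = begin
        W (suc k) x S
          ≈⟨ W-above (suc k) ⟩
        ∑ ℓ (λ y → first (suc k) S y when not (below y)) + [ r ℕ.* suc k ] ^ ∣ S ∣
          -- The constant of level k+1 is the whole alphabet at level k and telescopes once more
          -- there.
          ≈⟨ +-congˡ (trans (sym (T-letters k S)) (Tel.telescope k S)) ⟩
        ∑ ℓ (λ y → first (suc k) S y when not (below y)) + (∑ ℓ (first k S) + [ r ℕ.* k ] ^ ∣ S ∣)
          ≈⟨ +-congˡ (+-congʳ (trans (∑-cong ℓ λ y → sym (when-not (first k S y) (below y))) (sym (∑-+ _ _ ℓ)))) ⟩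
        ∑ ℓ (λ y → first (suc k) S y when not (below y))
          + (∑ ℓ (λ y → first k S y when below y) + ∑ ℓ (λ y → first k S y when not (below y)) + [ r ℕ.* k ] ^ ∣ S ∣)
          -- At level k the letters not below x, together with the constant, form `W k x S` again.
          ≈⟨ +-congˡ (trans (+-assoc _ _ _) (+-congˡ (sym (W-above k)))) ⟩
        ∑ ℓ (λ y → first (suc k) S y when not (below y)) + (∑ ℓ (λ y → first k S y when below y) + W k x S)
          ≈⟨ trans (sym (+-assoc _ _ _)) (+-comm _ _) ⟩
        W k x S + (∑ ℓ (λ y → first (suc k) S y when not (below y)) + ∑ ℓ (λ y → first k S y when below y))
          ≈⟨ +-congˡ (trans (∑-+ _ _ ℓ) (∑-cong ℓ λ y → if-when (first k S y) (first (suc k) S y) (below y))) ⟩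
        W k x S + ∑ ℓ (λ y → if below y then first k S y else first (suc k) S y) ∎
        where
        ℓ = letters r n
        when-not : ∀ a b → (a when b) + (a when not b) ≈ a
        when-not a true  = +-identityʳ a
        when-not a false = +-identityˡ a
        if-when : ∀ a a′ b → (a′ when not b) + (a when b) ≈ (if b then a else a′)
        if-when a a′ true  = +-identityˡ a
        if-when a a′ false = +-identityʳ a′

-- Substitution of z^r

module Spread (K : CommutativeRing 0ℓ 0ℓ) (_⁻¹ : Op₁ (CommutativeRing.Carrier K)) (r : ℕ) .{{_ : NonZero r}} where

  open CommutativeRing K hiding (zero)
  private
    module PS = PowerSeries rawRing _⁻¹
  open SeriesRing K _⁻¹
  private
    module S = CommutativeRing commutativeRing
  open RawSemiringDefs (RawRing.rawSemiring S.rawRing) using (_^_)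
  open SetoidReasoning setoid
  open Sums K

  Z : PS.Series
  Z = PS.z ^ r

  z*-zero : ∀ f → (PS.z S.* f) 0 ≈ 0#
  z*-zero f = trans (+-identityʳ _) (zeroˡ _)

  z*-suc : ∀ f m → (PS.z S.* f) (suc m) ≈ f m
  z*-suc f m = begin
    0# * f (suc m) + (tail PS.z S.* f) m ≈⟨ +-cong (zeroˡ _) (*-congₛ {g = f} tail-z (λ _ → refl) m) ⟩
    0# + (S.1# S.* f) m                  ≈⟨ trans (+-identityˡ _) (*-identityˡₛ f m) ⟩
    f m                                  ∎
    where
    tail-z : ∀ k → tail PS.z k ≈ PS.const 1# k
    tail-z zero    = refl
    tail-z (suc k) = refl

  z^*-< : ∀ r f m → m ℕ.< r → ((PS.z ^ r) S.* f) m ≈ 0#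
  z^*-< (suc r) f m m<r = trans (S.*-assoc PS.z (PS.z ^ r) f m) (go m m<r)
    where
    go : ∀ m → m ℕ.< suc r → (PS.z S.* ((PS.z ^ r) S.* f)) m ≈ 0#
    go zero    _   = z*-zero ((PS.z ^ r) S.* f)
    go (suc m) m<r = trans (z*-suc ((PS.z ^ r) S.* f) m) (z^*-< r f m (ℕ.s<s⁻¹ m<r))

  z^*-+ : ∀ r f m → ((PS.z ^ r) S.* f) (r ℕ.+ m) ≈ f m
  z^*-+ zero    f m = *-identityˡₛ f m
  z^*-+ (suc r) f m = begin
    ((PS.z ^ suc r) S.* f) (suc (r ℕ.+ m))         ≈⟨ S.*-assoc PS.z (PS.z ^ r) f (suc (r ℕ.+ m)) ⟩
    (PS.z S.* ((PS.z ^ r) S.* f)) (suc (r ℕ.+ m))  ≈⟨ z*-suc ((PS.z ^ r) S.* f) (r ℕ.+ m) ⟩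
    ((PS.z ^ r) S.* f) (r ℕ.+ m)                   ≈⟨ z^*-+ r f m ⟩
    f m                                            ∎

  -- The substitution f(z) ↦ f(z^r), given by its coefficients.
  spread : PS.Series → PS.Series
  spread f m = f (m ℕ./ r) when does (m ℕ.% r ℕ.≟ 0)

  spread-cong : ∀ {f g} → f S.≈ g → spread f S.≈ spread g
  spread-cong f≈g m = when-cong (does (m ℕ.% r ℕ.≟ 0)) (f≈g (m ℕ./ r))

  spread-+ : ∀ f g → spread (f S.+ g) S.≈ spread f S.+ spread g
  spread-+ f g m = sym (+-when _ _ (does (m ℕ.% r ℕ.≟ 0)))

  spread-0 : ∀ {f} → (∀ k → f k ≈ 0#) → spread f S.≈ S.0#
  spread-0 f≈0 m with does (m ℕ.% r ℕ.≟ 0)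
  ... | true  = trans (f≈0 (m ℕ./ r)) (sym (const-0 m))
  ... | false = sym (const-0 m)

  spread-· : ∀ a f → spread (a · f) S.≈ PS.const a S.* spread f
  spread-· a f m = sym (trans (const-* a (spread f) m) (*-when a _ (does (m ℕ.% r ℕ.≟ 0))))

  spread-∑ : ∀ {A : Set} xs (f : A → PS.Series) →
    spread (λ k → ∑ xs (λ x → f x k)) S.≈ Sums.∑ commutativeRing xs (λ x → spread (f x))
  spread-∑ []       f = spread-0 (λ _ → refl)
  spread-∑ (x ∷ xs) f m = trans (spread-+ (f x) (λ k → ∑ xs (λ x → f x k)) m) (+-congˡ (spread-∑ xs f m))

  spread-< : ∀ f m → m ℕ.< r → spread f m ≈ PS.const (f 0) m
  spread-< f m m<r rewrite ℕ.m<n⇒m/n≡0 m<r | ℕ.m<n⇒m%n≡m m<r = go m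
    where
    go : ∀ m → (f 0 when does (m ℕ.≟ 0)) ≈ PS.const (f 0) m
    go zero    = refl
    go (suc m) = refl

  -- This is f(Z) = f₀ + Z (tail f)(Z) with Z = z^r. Indices below r see only the constant; from r
  -- on, subtracting r lowers the quotient by one and keeps the remainder.
  spread-tail : ∀ f → spread f S.≈ PS.const (f 0) S.+ Z S.* spread (tail f)
  spread-tail f m with m ℕ.<? r
  ... | yes m<r = trans (spread-< f m m<r)
                    (sym (trans (+-congˡ (z^*-< r (spread (tail f)) m m<r)) (+-identityʳ _)))
  ... | no m≮r = ≡.subst (λ m → spread f m ≈ PS.const (f 0) m + (Z S.* spread (tail f)) m)
                   (ℕ.m+[n∸m]≡n (ℕ.≮⇒≥ m≮r)) (ge (m ∸ r))
    where
    ge : ∀ j → spread f (r ℕ.+ j) ≈ PS.const (f 0) (r ℕ.+ j) + (Z S.* spread (tail f)) (r ℕ.+ j)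
    ge j = begin
      spread f (r ℕ.+ j)
        ≡⟨ ≡.cong₂ (λ d e → f d when does (e ℕ.≟ 0)) quotient remainder ⟩
      spread (tail f) j
        ≈⟨ trans (+-identityˡ _) (z^*-+ r (spread (tail f)) j) ⟨
      0# + (Z S.* spread (tail f)) (r ℕ.+ j)
        ≡⟨ ≡.cong (_+ (Z S.* spread (tail f)) (r ℕ.+ j)) (const-r r) ⟨
      PS.const (f 0) (r ℕ.+ j) + (Z S.* spread (tail f)) (r ℕ.+ j) ∎
      where
      quotient : (r ℕ.+ j) ℕ./ r ≡ suc (j ℕ./ r)
      quotient = ≡.trans (ℕ.m/n≡1+[m∸n]/n (ℕ.m≤m+n r j)) (≡.cong (λ i → suc (i ℕ./ r)) (ℕ.m+n∸m≡n r j))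
      remainder : (r ℕ.+ j) ℕ.% r ≡ j ℕ.% r
      remainder = ≡.trans (≡.cong (ℕ._% r) (ℕ.+-comm r j)) (ℕ.[m+n]%n≡m%n j r)
      const-r : ∀ r .{{_ : NonZero r}} → PS.const (f 0) (r ℕ.+ j) ≡ 0#
      const-r (suc r) = ≡.refl

  shift : PS.Series → PS.Series
  shift f zero    = 0#
  shift f (suc k) = f k

  spread-shift : ∀ f → spread (shift f) S.≈ Z S.* spread f
  spread-shift f m = trans (spread-tail (shift f) m) (trans (+-congʳ (const-0 m)) (+-identityˡ _))

  spread-const : ∀ a → spread (PS.const a) S.≈ PS.const a
  spread-const a m = begin
    spread (PS.const a) m                                 ≈⟨ spread-tail (PS.const a) m ⟩
    PS.const a m + (Z S.* spread (tail (PS.const a))) m   ≈⟨ +-congˡ (S.*-congˡ {Z} (spread-0 (λ _ → refl)) m) ⟩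
    PS.const a m + (Z S.* S.0#) m                         ≈⟨ +-congˡ (trans (S.zeroʳ Z m) (const-0 m)) ⟩
    PS.const a m + 0#                                     ≈⟨ +-identityʳ _ ⟩
    PS.const a m                                          ∎

-- Peeling factors off the Pochhammer symbol

module Pochhammer (R : CommutativeRing 0ℓ 0ℓ) where

  open CommutativeRing R hiding (zero)
  open RawSemiringDefs (RawRing.rawSemiring rawRing) using (_^_; product)
  open QNotation rawRing using (pochhammer)
  open RingProperties ring using (-‿distribˡ-*)
  open SetoidReasoning setoid

  product-cong : ∀ {n} {f g : Fin n → Carrier} → (∀ i → f i ≈ g i) → product f ≈ product g
  product-cong {zero}  f≈g = refl
  product-cong {suc n} f≈g = *-cong (f≈g zero) (product-cong (f≈g ∘ suc))

  pochhammer-suc : ∀ a q n → pochhammer a q (suc n) ≈ (1# + - a) * pochhammer (a * q) q n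
  pochhammer-suc a q n = *-cong (+-congˡ (-‿cong (*-identityʳ a)))
    (product-cong {n} {λ i → 1# + - (a * q ^ suc (toℕ i))} {λ i → 1# + - (a * q * q ^ toℕ i)} λ i → +-congˡ (-‿cong (sym (*-assoc a q (q ^ toℕ i)))))

  -- Turns a recursive equation for a series into a statement about its multiple by 1 - a, without
  -- dividing.
  geometric : ∀ {a x e} → x ≈ a * x + e → (1# + - a) * x ≈ e
  geometric {a} {x} {e} p = begin
    (1# + - a) * x           ≈⟨ distribʳ x 1# (- a) ⟩
    1# * x + - a * x         ≈⟨ +-cong (trans (*-identityˡ x) p) (sym (-‿distribˡ-* a x)) ⟩
    a * x + e + - (a * x)    ≈⟨ +-congʳ (+-comm _ _) ⟩
    e + a * x + - (a * x)    ≈⟨ trans (+-assoc _ _ _) (+-congˡ (-‿inverseʳ _)) ⟩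
    e + 0#                   ≈⟨ +-identityʳ e ⟩
    e                        ∎

-- Generating series in the level

module LevelSeries (K : CommutativeRing 0ℓ 0ℓ) (_⁻¹ : Op₁ (CommutativeRing.Carrier K))
  (q : CommutativeRing.Carrier K)
  (1-q-inverseʳ : OneMinusInverts K _⁻¹ q)
  (r n : ℕ) .{{_ : NonZero r}}
  where

  open CommutativeRing K hiding (zero)
  private
    module PS = PowerSeries rawRing _⁻¹
  open SeriesRing K _⁻¹ hiding (sum-cong)
  private
    module S = CommutativeRing commutativeRing
    module SΣ = Sums commutativeRing
  open RawSemiringDefs (RawRing.rawSemiring rawRing) using (_^_)
  open RawSemiringDefs (RawRing.rawSemiring S.rawRing) using () renaming (_^_ to _^ₛ_)
  open Exp commutativeSemiring using (^-assocʳ; ^-distrib-*)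
  open Sums K using (∑; _when_; when-cong; *-when; ∑-cong; ∑-*)
  open QNumbers K _⁻¹ q 1-q-inverseʳ
  open Levels r n
  open Spread K _⁻¹ r

  const-*-hom : ∀ a b → PS.const (a * b) S.≈ PS.const a S.* PS.const b
  const-*-hom a b k = sym (trans (const-* a (PS.const b) k) (go k))
    where
    go : ∀ k → (a · PS.const b) k ≈ PS.const (a * b) k
    go zero    = refl
    go (suc k) = zeroʳ a

  const-^ : ∀ a k → PS.const (a ^ k) S.≈ PS.const a ^ₛ k
  const-^ a zero    = S.refl {S.1#}
  const-^ a (suc k) = S.trans {PS.const (a * a ^ k)} {PS.const a S.* PS.const (a ^ k)} {PS.const a ^ₛ suc k}
    (const-*-hom a (a ^ k)) (S.*-congˡ {PS.const a} (const-^ a k))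

  -- The coefficients of A(x,S)(aZ) in powers of Z.
  level : Carrier → Symbol r n → Subset n → PS.Series
  level a x S k = a ^ k * W k x S

  after : Carrier → Subset n → Letter r n → PS.Series
  after a S y k = q ^ toℕ (proj₂ y) * level (a * q ^ r) ⌊ y ⌋ (S [ proj₁ y ]≔ false) k when lookup S (proj₁ y)

  -- Every coefficient of W is the empty product 1, so this is the equation of the geometric series
  -- in aZ.
  level-∅ : ∀ a x S → ∣ S ∣ ≡ 0 → level a x S S.≈ shift (a · level a x S) S.+ S.1#
  level-∅ a x S S≡0 zero    = trans (trans (*-identityˡ _) (W-∅ 0 x S S≡0)) (sym (+-identityˡ _))
  level-∅ a x S S≡0 (suc k) = trans (*-congˡ (W-∅ (suc k) x S S≡0))
    (trans (*-assoc a (a ^ k) _) (trans (*-congˡ (*-congˡ (sym (W-∅ k x S S≡0)))) (sym (+-identityʳ _))))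

  module _ (a : Carrier) (x : Symbol r n) (S : Subset n) where

    open SetoidReasoning setoid
    open Solver commutativeSemiring using (solve; _:=_; _:*_)

    ℓ = letters r n

    -- The factor q^{rk} of a letter on level k is the k-th power of q^r and merges with a^k.
    first-after : ∀ k y → a ^ k * first k S y ≈ after a S y k
    first-after k y = trans (*-when _ _ (lookup S (proj₁ y))) (when-cong (lookup S (proj₁ y)) (begin
      a ^ k * (q ^ (r ℕ.* k) * qᶜ * w)
        ≈⟨ solve 4 (λ a b c w → a :* (b :* c :* w) := c :* ((a :* b) :* w)) refl _ _ _ _ ⟩
      qᶜ * ((a ^ k * q ^ (r ℕ.* k)) * w)
        ≈⟨ *-congˡ (*-congʳ (trans (^-distrib-* a (q ^ r) k) (*-congˡ (^-assocʳ q r k)))) ⟨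
      qᶜ * ((a * q ^ r) ^ k * w) ∎))
      where
      qᶜ = q ^ toℕ (proj₂ y)
      w = W k ⌊ y ⌋ (S [ proj₁ y ]≔ false)

    step : Letter r n → PS.Series
    step y = if does (⌊ y ⌋ ≺? x) then shift (a · after a S y) else after a S y

    -- A first letter below x comes from the preceding level, which explains the shift in `step`;
    -- this is the factor Z of a descent.
    level-recursion : Fresh S x → ∣ S ∣ ≢ 0 → level a x S S.≈ shift (a · level a x S) S.+ (λ k → ∑ ℓ (λ y → step y k))
    level-recursion fresh S≢0 zero = begin
      1# * W 0 x S
        ≈⟨ trans (*-congˡ (W-zero x S fresh S≢0)) (∑-* _ _ ℓ) ⟩
      ∑ ℓ (λ y → 1# * (first 0 S y when not (does (⌊ y ⌋ ≺? x))))
        ≈⟨ ∑-cong ℓ (λ y → go y (does (⌊ y ⌋ ≺? x))) ⟩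
      ∑ ℓ (λ y → step y 0)
        ≈⟨ +-identityˡ _ ⟨
      0# + ∑ ℓ (λ y → step y 0) ∎
      where
      go : ∀ y b → 1# * (first 0 S y when not b) ≈ (if b then shift (a · after a S y) else after a S y) 0
      go y true  = zeroʳ 1#
      go y false = first-after 0 y
    level-recursion fresh S≢0 (suc k) = begin
      a ^ suc k * W (suc k) x S
        ≈⟨ *-congˡ (W-suc x S fresh k) ⟩
      a ^ suc k * (W k x S + ∑ ℓ (λ y → if does (⌊ y ⌋ ≺? x) then first k S y else first (suc k) S y))
        ≈⟨ trans (distribˡ _ _ _) (+-cong (*-assoc a (a ^ k) _) (∑-* _ _ ℓ)) ⟩
      a * level a x S k + ∑ ℓ (λ y → a ^ suc k * (if does (⌊ y ⌋ ≺? x) then first k S y else first (suc k) S y))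
        ≈⟨ +-congˡ (∑-cong ℓ λ y → go y (does (⌊ y ⌋ ≺? x))) ⟩
      a * level a x S k + ∑ ℓ (λ y → step y (suc k)) ∎
      where
      go : ∀ y b → a ^ suc k * (if b then first k S y else first (suc k) S y)
             ≈ (if b then shift (a · after a S y) else after a S y) (suc k)
      go y true  = trans (*-assoc a (a ^ k) _) (*-congˡ (first-after k y))
      go y false = first-after (suc k) y

-- Comparison of level series and word sums

module WordSeries (K : CommutativeRing 0ℓ 0ℓ) (_⁻¹ : Op₁ (CommutativeRing.Carrier K))
  (q : CommutativeRing.Carrier K)
  (1-q-inverseʳ : OneMinusInverts K _⁻¹ q)
  (r n : ℕ) .{{_ : NonZero r}}
  where

  private
    module K = CommutativeRing K
    module PS = PowerSeries K.rawRing _⁻¹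
  open SeriesRing K _⁻¹ using (commutativeRing; _·_)
  private
    module S = CommutativeRing commutativeRing
    module SΣ = Sums commutativeRing
  open S using (_≈_; _+_; _*_; -_; 1#; 0#)
  open RawSemiringDefs (RawRing.rawSemiring K.rawRing) using (_^_)
  open RawSemiringDefs (RawRing.rawSemiring S.rawRing) using () renaming (_^_ to _^ₛ_)
  open Sums K using (∑; _when_)
  open LevelSeries K _⁻¹ q 1-q-inverseʳ r n
  open Spread K _⁻¹ r
  open WordSums commutativeRing r n (PS.const q) using (wordSum; wordSum-zero; wordSum-suc; jump)
  open QNotation S.rawRing using (pochhammer)
  open Pochhammer commutativeRing
  open SetoidReasoning S.setoid
  open Solver S.commutativeSemiring using (solve; _:=_; _:*_)

  Q : PS.Series
  Q = PS.const q

  H : K.Carrier → Symbol r n → Subset n → PS.Series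
  H a x S = spread (level a x S)

  spread-shift-· : ∀ {Y a} → Y ≈ PS.const a * Z → ∀ f → spread (shift (a · f)) ≈ Y * spread f
  spread-shift-· {Y} {a} Y≈ f = begin
    spread (shift (a · f))        ≈⟨ spread-shift (a · f) ⟩
    Z * spread (a · f)            ≈⟨ S.*-congˡ {Z} (spread-· a f) ⟩
    Z * (PS.const a * spread f)   ≈⟨ S.*-assoc Z (PS.const a) (spread f) ⟨
    Z * PS.const a * spread f     ≈⟨ S.*-congʳ {spread f} (S.*-comm Z (PS.const a)) ⟩
    PS.const a * Z * spread f     ≈⟨ S.*-congʳ {spread f} Y≈ ⟨
    Y * spread f                  ∎

  spread-step : ∀ {Y a} → Y ≈ PS.const a * Z → ∀ f b →
    spread (if b then shift (a · f) else f) ≈ jump Y b * spread f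
  spread-step Y≈ f true  = spread-shift-· Y≈ f
  spread-step Y≈ f false = S.sym (S.*-identityˡ (spread f))

  spread-when : ∀ c f b →
    spread (λ k → K._*_ (q ^ c) (f k) when b) ≈ (Q ^ₛ c * spread f SΣ.when b)
  spread-when c f false = spread-0 (λ _ → K.refl)
  spread-when c f true  = S.trans (spread-· (q ^ c) f) (S.*-congʳ {spread f} (const-^ q c))

  -- Keeps the variable Y of the word sums and the scalar a of the level series in step through the
  -- induction.
  next-argument : ∀ {Y a} → Y ≈ PS.const a * Z → Y * Q ^ₛ r ≈ PS.const (K._*_ a (q ^ r)) * Z
  next-argument {Y} {a} Y≈ = begin
    Y * Q ^ₛ r                              ≈⟨ S.*-cong Y≈ (S.sym (const-^ q r)) ⟩
    PS.const a * Z * PS.const (q ^ r)       ≈⟨ solve 3 (λ a z p → a :* z :* p := a :* p :* z) S.refl (PS.const a) Z (PS.const (q ^ r)) ⟩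
    PS.const a * PS.const (q ^ r) * Z       ≈⟨ S.*-congʳ {Z} (const-*-hom a (q ^ r)) ⟨
    PS.const (K._*_ a (q ^ r)) * Z ∎

  -- Induction on the number of values left. The factor 1 - Y absorbs the recursive term of the
  -- level series, and the rest of the Pochhammer symbol, based at `Y * Q ^ₛ r`, is the one required
  -- by each summand.
  pochhammer-H : ∀ m {Y a x} {S : Subset n} → Y ≈ PS.const a * Z → ∣ S ∣ ≡ m → Fresh S x →
    pochhammer Y (Q ^ₛ r) (suc m) * H a x S ≈ wordSum m Y x S
  pochhammer-H zero {Y} {a} {x} {S} Y≈ S≡0 fresh = begin
    pochhammer Y (Q ^ₛ r) 1 * H a x S
      ≈⟨ S.*-congʳ {H a x S} (pochhammer-suc Y (Q ^ₛ r) 0) ⟩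
    (1# + - Y) * 1# * H a x S
      ≈⟨ S.*-congʳ {H a x S} (S.*-identityʳ (1# + - Y)) ⟩
    (1# + - Y) * H a x S
      ≈⟨ geometric {Y} {H a x S} {1#} (begin
           H a x S
             ≈⟨ spread-cong (level-∅ a x S S≡0) ⟩
           spread (shift (a · level a x S) + 1#)
             ≈⟨ spread-+ (shift (a · level a x S)) 1# ⟩
           spread (shift (a · level a x S)) + spread 1#
             ≈⟨ S.+-cong (spread-shift-· Y≈ (level a x S)) (spread-const (K.1#)) ⟩
           Y * H a x S + 1# ∎) ⟩
    1#
      ≈⟨ wordSum-zero Y x S ⟨
    wordSum 0 Y x S ∎
  pochhammer-H (suc m) {Y} {a} {x} {S} Y≈ S≡ fresh = begin
    pochhammer Y (Q ^ₛ r) (suc (suc m)) * H a x S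
      ≈⟨ S.*-congʳ {H a x S} (pochhammer-suc Y (Q ^ₛ r) (suc m)) ⟩
    (1# + - Y) * P * H a x S
      ≈⟨ solve 3 (λ u p h → u :* p :* h := p :* (u :* h)) S.refl (1# + - Y) P (H a x S) ⟩
    P * ((1# + - Y) * H a x S)
      ≈⟨ S.*-congˡ {P} (geometric {Y} {H a x S} {SΣ.∑ (letters r n) next} (begin
           H a x S
             ≈⟨ spread-cong (level-recursion a x S fresh S≢0) ⟩
           spread (shift (a · level a x S) + (λ k → ∑ (letters r n) (λ y → step a x S y k)))
             ≈⟨ spread-+ (shift (a · level a x S)) (λ k → ∑ (letters r n) (λ y → step a x S y k)) ⟩
           spread (shift (a · level a x S)) + spread (λ k → ∑ (letters r n) (λ y → step a x S y k))
             ≈⟨ S.+-cong (spread-shift-· Y≈ (level a x S)) (spread-∑ (letters r n) (step a x S)) ⟩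
           Y * H a x S + SΣ.∑ (letters r n) (λ y → spread (step a x S y))
             ≈⟨ S.+-congˡ {Y * H a x S} (SΣ.∑-cong (letters r n) λ y → S.trans
                  (spread-step Y≈ (after a S y) (does (⌊ y ⌋ ≺? x)))
                  (S.*-congˡ {jump Y (does (⌊ y ⌋ ≺? x))} (spread-when (toℕ (proj₂ y)) (level (K._*_ a (q ^ r)) ⌊ y ⌋ (S [ proj₁ y ]≔ false)) (lookup S (proj₁ y))))) ⟩
           Y * H a x S + SΣ.∑ (letters r n) next ∎)) ⟩
    P * SΣ.∑ (letters r n) next
      ≈⟨ SΣ.∑-* P next (letters r n) ⟩
    SΣ.∑ (letters r n) (λ y → P * next y)
      ≈⟨ SΣ.∑-cong (letters r n) induct ⟩
    SΣ.∑ (letters r n) (λ y → jump Y (does (⌊ y ⌋ ≺? x)) * Q ^ₛ toℕ (proj₂ y) * wordSum m (Y * Q ^ₛ r) ⌊ y ⌋ (S [ proj₁ y ]≔ false)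
                                SΣ.when lookup S (proj₁ y))
      ≈⟨ wordSum-suc m Y x S ⟨
    wordSum (suc m) Y x S ∎
    where
    P = pochhammer (Y * Q ^ₛ r) (Q ^ₛ r) (suc m)
    Hʸ : Letter r n → PS.Series
    Hʸ y = H (K._*_ a (q ^ r)) ⌊ y ⌋ (S [ proj₁ y ]≔ false)
    next : Letter r n → PS.Series
    next y = jump Y (does (⌊ y ⌋ ≺? x)) * (Q ^ₛ toℕ (proj₂ y) * Hʸ y SΣ.when lookup S (proj₁ y))
    S≢0 : ∣ S ∣ ≢ 0
    S≢0 S≡0 with () ← ≡.trans (≡.sym S≡) S≡0
    induct : ∀ y → P * next y ≈
      (jump Y (does (⌊ y ⌋ ≺? x)) * Q ^ₛ toℕ (proj₂ y) * wordSum m (Y * Q ^ₛ r) ⌊ y ⌋ (S [ proj₁ y ]≔ false)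
        SΣ.when lookup S (proj₁ y))
    induct y with lookup S (proj₁ y) in y∈S
    ... | false = S.trans (S.*-congˡ {P} (S.zeroʳ (jump Y (does (⌊ y ⌋ ≺? x))))) (S.zeroʳ P)
    ... | true  = begin
      P * (j * (Qᶜ * Hʸ y))
        ≈⟨ solve 4 (λ p j c h → p :* (j :* (c :* h)) := j :* c :* (p :* h)) S.refl P j Qᶜ (Hʸ y) ⟩
      j * Qᶜ * (P * Hʸ y)
        -- Removing the value of y lowers the cardinality by one and makes y fresh for what is left.
        ≈⟨ S.*-congˡ {j * Qᶜ} (pochhammer-H m {Y * Q ^ₛ r} {K._*_ a (q ^ r)} {⌊ y ⌋}
             (next-argument Y≈) (ℕ.suc-injective (≡.trans (≡.sym (∣S∣-remove S (proj₁ y) y∈S)) S≡)) (Fresh-remove S y)) ⟩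
      j * Qᶜ * wordSum m (Y * Q ^ₛ r) ⌊ y ⌋ (S [ proj₁ y ]≔ false) ∎
      where
      j = jump Y (does (⌊ y ⌋ ≺? x))
      Qᶜ = Q ^ₛ toℕ (proj₂ y)

-- The indices congruent to 1

suc-%⁺ : ∀ m r .{{_ : NonZero r}} → m ℕ.% r ≡ 0 → suc m ℕ.% r ≡ 1 ℕ.% r
suc-%⁺ m r m%r≡0 = ≡.trans (≡.cong (λ m → suc m ℕ.% r) m≡) (ℕ.[m+kn]%n≡m%n 1 (m ℕ./ r) r)
  where
  m≡ : m ≡ m ℕ./ r ℕ.* r
  m≡ = ≡.trans (ℕ.m≡m%n+[m/n]*n m r) (≡.cong (ℕ._+ m ℕ./ r ℕ.* r) m%r≡0)

-- The residue is kept as `1 % r` because it is 0 for r = 1. With 1 = s + j r and suc m = s + k r,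
-- adding j r to m gives k r, a multiple of r.
suc-%⁻ : ∀ m r .{{_ : NonZero r}} → suc m ℕ.% r ≡ 1 ℕ.% r → m ℕ.% r ≡ 0
suc-%⁻ m r eq = begin
  m ℕ.% r                    ≡⟨ ℕ.[m+kn]%n≡m%n m j r ⟨
  (m ℕ.+ j ℕ.* r) ℕ.% r      ≡⟨ ≡.cong (ℕ._% r) (ℕ.+-cancelˡ-≡ 1 _ _ (begin
    suc (m ℕ.+ j ℕ.* r)                   ≡⟨ ≡.cong (ℕ._+ j ℕ.* r) (ℕ.m≡m%n+[m/n]*n (suc m) r) ⟩
    suc m ℕ.% r ℕ.+ k ℕ.* r ℕ.+ j ℕ.* r   ≡⟨ ≡.cong (λ s → s ℕ.+ k ℕ.* r ℕ.+ j ℕ.* r) eq ⟩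
    s ℕ.+ k ℕ.* r ℕ.+ j ℕ.* r             ≡⟨ ℕ.+-assoc s (k ℕ.* r) (j ℕ.* r) ⟩
    s ℕ.+ (k ℕ.* r ℕ.+ j ℕ.* r)           ≡⟨ ≡.cong (s ℕ.+_) (ℕ.+-comm (k ℕ.* r) (j ℕ.* r)) ⟩
    s ℕ.+ (j ℕ.* r ℕ.+ k ℕ.* r)           ≡⟨ ℕ.+-assoc s (j ℕ.* r) (k ℕ.* r) ⟨
    s ℕ.+ j ℕ.* r ℕ.+ k ℕ.* r             ≡⟨ ≡.cong (ℕ._+ k ℕ.* r) (ℕ.m≡m%n+[m/n]*n 1 r) ⟨
    suc (k ℕ.* r)                         ∎)) ⟩
  (k ℕ.* r) ℕ.% r            ≡⟨ ℕ.m*n%n≡0 k r ⟩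
  0                          ∎
  where
  open ≡.≡-Reasoning
  s = 1 ℕ.% r
  j = 1 ℕ./ r
  k = suc m ℕ./ r

-- The identity over a field

module Theorem (K : CommutativeRing 0ℓ 0ℓ) (_⁻¹ : Op₁ (CommutativeRing.Carrier K))
  (isFieldInverse : IsFieldInverse K _⁻¹)
  (q : CommutativeRing.Carrier K) (1-q≉0 : OneMinusNonzero K _⁻¹ q)
  (r n : ℕ) .{{_ : NonZero r}} .{{_ : NonZero n}}
  where

  open CommutativeRing K hiding (zero)
  open IsFieldInverse isFieldInverse
  private
    module PS = PowerSeries rawRing _⁻¹
  open SeriesRing K _⁻¹ hiding (sum-cong)
  private
    module S = CommutativeRing commutativeRing
    1-q-inverseʳ = inverseʳ (1# + - q) 1-q≉0
  open RawSemiringDefs (RawRing.rawSemiring rawRing) using (_^_)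
  open RawSemiringDefs (RawRing.rawSemiring S.rawRing) using (product) renaming (_^_ to _^ₛ_)
  open RingProperties ring using (-0#≈0#)
  open QNumbers K _⁻¹ q 1-q-inverseʳ
  open Levels r n
  open WordSeries K _⁻¹ q 1-q-inverseʳ r n
  open Spread K _⁻¹ r
  open WordSums commutativeRing r n (PS.const q) using (generatingPolynomial-wordSum)
  open QNotation S.rawRing using (pochhammer)
  private
    module 𝓛 = Lq rawRing _⁻¹ q

  Z-0 : ∀ r .{{_ : NonZero r}} → (PS.z ^ₛ r) 0 ≈ 0#
  Z-0 (suc r) = z*-zero (PS.z ^ₛ r)

  -- Each factor has constant term 1 when a has none. For a = z^r with r ≥ 1 the denominator is
  -- therefore invertible as a series.
  pochhammer-0 : ∀ a p m → a 0 ≈ 0# → pochhammer a p m 0 ≈ 1#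
  pochhammer-0 a p m a₀ = go m (λ i → p ^ₛ toℕ i)
    where
    factor-0 : ∀ g → (S.1# S.+ S.- (a S.* g)) 0 ≈ 1#
    factor-0 g = trans (+-congˡ (trans (-‿cong (trans (+-identityʳ _) (trans (*-congʳ a₀) (zeroˡ _)))) -0#≈0#)) (+-identityʳ 1#)
    go : ∀ m (g : Fin m → PS.Series) → product (λ i → S.1# S.+ S.- (a S.* g i)) 0 ≈ 1#
    go zero    g = refl
    go (suc m) g = trans (+-identityʳ _) (trans (*-cong (factor-0 (g zero)) (go m (g ∘ suc))) (*-identityˡ 1#))

  level-𝟎 : ∀ k → 1# ^ k * W k 𝟎 ⊤ ≈ [ r ℕ.* k ℕ.+ 1 ] ^ n
  level-𝟎 k = trans (*-cong (1^ k) (trans (W-𝟎 k ⊤) (reflexive (≡.cong ([ r ℕ.* k ℕ.+ 1 ] ^_) (Subset.∣⊤∣≡n n))))) (*-identityˡ _)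
    where
    1^ : ∀ k → 1# ^ k ≈ 1#
    1^ zero    = refl
    1^ (suc k) = trans (*-identityˡ _) (1^ k)

  -- The indices in question are m+1 with m divisible by r; writing m = rk, the coefficient [rk+1]^n
  -- is that of level k at 𝟎.
  L-spread : 𝓛.L n 1 r S.≈ PS.z S.* H 1# 𝟎 ⊤
  L-spread zero    = sym (z*-zero (H 1# 𝟎 ⊤))
  L-spread (suc m) = trans (go m) (sym (z*-suc (H 1# 𝟎 ⊤) m))
    where
    go : ∀ m → 𝓛.L n 1 r (suc m) ≈ H 1# 𝟎 ⊤ m
    go m with (1 ℕ.≤? suc m) ×-dec (suc m ℕ.% r ℕ.≟ 1 ℕ.% r)
    ... | yes (_ , eq) rewrite dec-true (m ℕ.% r ℕ.≟ 0) (suc-%⁻ m r eq) =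
      trans (reflexive (≡.cong (λ m → [ m ] ^ n) sm≡)) (sym (level-𝟎 (m ℕ./ r)))
      where
      sm≡ : suc m ≡ r ℕ.* (m ℕ./ r) ℕ.+ 1
      sm≡ = ≡.trans (≡.cong suc (≡.trans (ℕ.m≡m%n+[m/n]*n m r)
              (≡.cong₂ ℕ._+_ (suc-%⁻ m r eq) (ℕ.*-comm (m ℕ./ r) r)))) (ℕ.+-comm 1 _)
    ... | no ¬p rewrite dec-false (m ℕ.% r ℕ.≟ 0) (λ eq → ¬p (ℕ.s≤s ℕ.z≤n , suc-%⁺ m r eq)) = refl

  theorem : 𝓛.L n 1 r S.≈ PS.z S.* (generatingPolynomial S.rawRing r n (PS.z ^ₛ r) (PS.const q)
                     PS./ pochhammer (PS.z ^ₛ r) (PS.const q ^ₛ r) (suc n))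
  theorem = S.trans L-spread (S.*-congˡ {PS.z} (S.sym quotient))
    where
    open SetoidReasoning S.setoid
    P = pochhammer Z (PS.const q ^ₛ r) (suc n)
    P₀≉0 : ¬ P 0 ≈ 0#
    P₀≉0 P₀≈0 = 1≉0 (trans (sym (pochhammer-0 Z (PS.const q ^ₛ r) (suc n) (Z-0 r))) P₀≈0)
    P-inverseʳ : P S.* PS.recip P S.≈ S.1#
    P-inverseʳ = recip-inverseʳ P (inverseʳ (P 0) P₀≉0)
    PH≈G : P S.* H 1# 𝟎 ⊤ S.≈ generatingPolynomial S.rawRing r n Z (PS.const q)
    PH≈G = S.trans (pochhammer-H n {Z} {1#} {𝟎} {⊤} (S.sym (S.*-identityˡ Z)) (Subset.∣⊤∣≡n n) (λ _ _ ()))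
                   (S.sym (generatingPolynomial-wordSum Z))
    quotient : generatingPolynomial S.rawRing r n Z (PS.const q) PS./ P S.≈ H 1# 𝟎 ⊤
    quotient = begin
      generatingPolynomial S.rawRing r n Z (PS.const q) S.* PS.recip P
        ≈⟨ S.*-congʳ {PS.recip P} PH≈G ⟨
      P S.* H 1# 𝟎 ⊤ S.* PS.recip P
        ≈⟨ S.*-congʳ {PS.recip P} (S.*-comm P (H 1# 𝟎 ⊤)) ⟩
      H 1# 𝟎 ⊤ S.* P S.* PS.recip P
        ≈⟨ S.*-assoc (H 1# 𝟎 ⊤) P (PS.recip P) ⟩
      H 1# 𝟎 ⊤ S.* (P S.* PS.recip P)
        ≈⟨ S.*-congˡ {H 1# 𝟎 ⊤} P-inverseʳ ⟩
      H 1# 𝟎 ⊤ S.* S.1#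
        ≈⟨ S.*-identityʳ (H 1# 𝟎 ⊤) ⟩
      H 1# 𝟎 ⊤ ∎

-- A record and not the bare equation: two of its instances are compared by
-- comparing the operations, without computing coefficients in ℚ(q).
record Identity {A : Set} (_≈_ : A → A → Set) (_*_ _/_ : A → A → A) (_^_ : A → ℕ → A)
  (G : (r n : ℕ) → A → A → A) (pochhammer : A → A → ℕ → A) (L z q : A) (r n : ℕ) : Set where
  constructor identity
  field
    identityHolds : L ≈ (z * (G r n (z ^ r) q / pochhammer (z ^ r) (q ^ r) (suc n)))

open Identity

-- Specialisation to ℚ(q)

module _ (K : RawRing 0ℓ 0ℓ) (_⁻¹ : Op₁ (RawRing.Carrier K)) where

  open RawRing K
  private
    module PS = PowerSeries K _⁻¹
    module S = RawRing PS.rawRing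
  open RawSemiringDefs S.rawSemiring using () renaming (_^_ to _^ₛ_)

  module _ (isCommutativeRing : IsCommutativeRing _≈_ _+_ _*_ -_ 0# 1#) where

    bundle : CommutativeRing 0ℓ 0ℓ
    bundle = record { isCommutativeRing = isCommutativeRing }

    theorem-rawRing : IsFieldInverse bundle _⁻¹ →
      (q : Carrier) → OneMinusNonzero bundle _⁻¹ q → (r n : ℕ) .{{_ : NonZero r}} .{{_ : NonZero n}} →
      Identity S._≈_ S._*_ PS._/_ _^ₛ_ (generatingPolynomial PS.rawRing) (QNotation.pochhammer PS.rawRing)
        (Lq.L K _⁻¹ q n 1 r) PS.z (PS.const q) r n
    theorem-rawRing isFieldInverse q 1-q≉0 r n = identity (Theorem.theorem bundle _⁻¹ isFieldInverse q 1-q≉0 r n)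

⁻¹-isFieldInverse : IsFieldInverse ℚ⟨q⟩-commutativeRing Frac._⁻¹
⁻¹-isFieldInverse = record { inverseʳ = ⁻¹-inverseʳ ; 1≉0 = 1≉0-Frac }

open import Algebra.Definitions.RawSemiring (RawRing.rawSemiring ℚ⟨q⟩⟦z⟧) using (_^_)
open RawRing ℚ⟨q⟩⟦z⟧ using (_≈_; _*_)
open QNotation ℚ⟨q⟩⟦z⟧ using (pochhammer)

theorem-ℚ⟨q⟩ : (r n : ℕ) .{{_ : NonZero r}} .{{_ : NonZero n}} →
  Identity _≈_ _*_ _/_ _^_ (generatingPolynomial ℚ⟨q⟩⟦z⟧) pochhammer (L n 1 r) z (const q) r n
theorem-ℚ⟨q⟩ =
  theorem-rawRing ℚ⟨q⟩-rawRing Frac._⁻¹ (CommutativeRing.isCommutativeRing ℚ⟨q⟩-commutativeRing)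
    ⁻¹-isFieldInverse q 1-q≉0

mainTheorem4 : (r n : ℕ) .{{_ : NonZero r}} .{{_ : NonZero n}} →
    L n 1 r ≈ z * (generatingPolynomial ℚ⟨q⟩⟦z⟧ r n (z ^ r) (const q)
                     / pochhammer (z ^ r) (const q ^ r) (suc n))
mainTheorem4 r n = identityHolds (theorem-ℚ⟨q⟩ r n)
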